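{- For every $2 \leqslant s \leqslant t$, there exist constants $C > 0$, $\delta > 0$ and $k_0 \in \mathbb{N}$ (and a constant $c > 0$) such that the following holds for every $k \geqslant k_0$ and every $n \in \mathbb{N}$. Given a graph $G$ with $n$ vertices and $k n^{2-1/s}$ edges, there exists a set $\mathcal{H}$ of ordered pairs $(S,T)$ with $S, T \subset V(G)$, $|S| = s$, $|T| = t$ and $G[S,T]$ a complete bipartite graph (i.e., every vertex of $S$ is adjacent to every vertex of $T$), such that: (a) $|\mathcal{H}| \geqslant c\, k^{st} n^s$, and (b) $d_{\mathcal{H}}(A,B) \leqslant D^{(|A|,|B|)}(k,n)$ for all $A, B \subset V(G)$ with $1 \leqslant |A| \leqslant s$ and $1 \leqslant |B| \leqslant t$.
   Context: For $A, B \subset V(G)$, $d_{\mathcal{H}}(A,B) = |\{(S,T) \in \mathcal{H} : A \subset S \text{ and } B \subset T\}|$. For $1 \leqslant i \leqslant s$ and $1 \leqslant j \leqslant t$, $D^{(i,j)}(k,n) = (\delta k n^{(s-1)/s})^{s-i} (\delta k^s)^{t-j}$, where $\delta$ is the constant of the statement. The paper writes (a) as $e(\mathcal{H}) = \Omega(k^{st} n^s)$, meaning at least a constant (depending only on $s,t$) times $k^{st}n^s$. -}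

module Defs where

open import Data.Nat as ℕ using (ℕ; zero; suc; _<ᵇ_)
open import Data.Bool using (Bool; true; false; _∧_; if_then_else_)
open import Data.Fin using (Fin; toℕ)
open import Data.Fin.Subset using (Subset; _∈_; _⊆_)
open import Data.Fin.Subset.Properties using (_⊆?_)
open import Data.List using (List; map; allFin; filter; length)
open import Data.Nat.ListAction using (sum)
open import Data.Product using (_×_; _,_)
open import Data.Rational using (ℚ; 1ℚ; _*_)
open import Relation.Binary.PropositionalEquality using (_≡_)
open import Relation.Nullary using (Dec; yes; no; _×-dec_)

record Graph (n : ℕ) : Set where
  field
    Adj   : Fin n → Fin n → Bool
    sym   : ∀ i j → Adj i j ≡ Adj j i
    irrefl : ∀ i → Adj i i ≡ false
open Graph public

edges : ∀ {n} → Graph n → ℕ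
edges {n} G = sum (map (λ i → sum (map (λ j →
  if (toℕ i <ᵇ toℕ j) ∧ Adj G i j then 1 else 0) (allFin n))) (allFin n))

CompleteBetween : ∀ {n} → Graph n → Subset n → Subset n → Set
CompleteBetween G S T = ∀ u v → u ∈ S → v ∈ T → Adj G u v ≡ true

dH : ∀ {n} → List (Subset n × Subset n) → Subset n → Subset n → ℕ
dH H A B = length (filter (λ { (S , T) → (A ⊆? S) ×-dec (B ⊆? T) }) H)

_^ℚ_ : ℚ → ℕ → ℚ
q ^ℚ zero = 1ℚ
q ^ℚ suc m = q * (q ^ℚ m)

open import Data.Integer using (+_)
import Data.Rational as Q
fromℕ : ℕ → ℚ
fromℕ m = (+ m) Q./ 1

{-# OPTIONS --safe #-}
module Submission where

-- Let M ≈ e / n and Q ≈ Mˢ / nˢ⁻¹ up to constants, D(i,j) = M^(s-i) Q^(t-j), and call (A,B) saturated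
-- when d_H(A,B) ≥ D(|A|,|B|). Starting from H = ∅, pairs (S,T) none of whose nonempty sub-pairs (A,B)
-- is saturated are added one at a time, which preserves (b); since D(s,t) = 1, such a pair is new.
-- It remains to find one while 2 s t |H| < e D(1,1). Double counting gives
-- Σ_u d_H(A ∪ u, B) ≤ s d_H(A,B), so an unsaturated (A,B) has at most s M vertices u with
-- (A ∪ u, B) saturated, and likewise at most t Q on the other side; moreover at most half of the edges
-- are saturated. Hence, for each v, many s-tuples of neighbours of v have no saturated
-- (A,{v}), and by pigeonhole some tuple works for a constant times Q many v. Among these v the
-- vertices of T are picked greedily.

open import Defs hiding (sym)
open import Data.Bool using (Bool; true; false; _∧_; not; T; if_then_else_)
open import Data.Bool.ListAction using (all)
open import Data.Bool.Properties using (∧-comm)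
open import Data.Empty using (⊥-elim)
open import Data.Fin using (Fin; zero; suc; toℕ)
import Data.Fin as Fin
open import Data.Fin.Subset using (Subset; Nonempty; ∣_∣; ⁅_⁆; _∪_; _-_; ⊥)
  renaming (_∈_ to _∈ˢ_; _∉_ to _∉ˢ_; _⊆_ to _⊆ˢ_)
open import Data.Fin.Subset.Properties
  using (_⊆?_; _∈?_; nonempty?; p⊆p∪q; q⊆p∪q; x∈p∪q⁻; x∈⁅x⁆; x∈⁅y⁆⇒x≡y; ∣⁅x⁆∣≡1; ∣⊥∣≡0;
         ⊆-antisym; ∪-identityˡ; ∪-identityʳ; x∈p∧x≢y⇒x∈p-y; p─q⊆p; ∉⊥; Empty-unique)
import Data.Integer as ℤ
import Data.Integer.Properties as ℤ
open import Data.List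
  using (List; []; _∷_; _++_; length; map; allFin; tabulate; concatMap; cartesianProductWith)
open import Data.List.Membership.Propositional using (_∈_)
open import Data.List.Membership.Propositional.Properties
  using (∈-map⁺; ∈-map⁻; ∈-++⁺ˡ; ∈-++⁺ʳ; ∈-++⁻; ∈-cartesianProductWith⁺; ∈-cartesianProductWith⁻)
open import Data.List.Properties
  using (map-tabulate; map-++; length-tabulate; length-map; length-++; length-filter)
open import Data.List.Relation.Unary.All using (All; []; _∷_)
import Data.List.Relation.Unary.All as All
open import Data.List.Relation.Unary.AllPairs using ([]; _∷_)
open import Data.List.Relation.Unary.Any using (here; there)
open import Data.List.Relation.Unary.Unique.Propositional using (Unique)
open import Data.Nat
open import Data.Nat.DivMod using (m/n*n≤m; m≡m%n+[m/n]*n; m%n<n; m≥n⇒m/n>0)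
open import Data.Nat.ListAction using (sum)
open import Data.Nat.ListAction.Properties using (sum-++)
open import Data.Nat.Properties
open import Data.Nat.Tactic.RingSolver using (solve-∀)
open import Data.Product using (Σ; ∃; _×_; _,_; proj₁; proj₂)
open import Data.Rational using (ℚ; 0ℚ; 1ℚ) renaming (_<_ to _<ℚ_; _≤_ to _≤ℚ_; _*_ to _*ℚ_)
import Data.Rational as ℚ
import Data.Rational.Properties as ℚ
open import Data.Rational.Unnormalised using (mkℚᵘ; *≡*; *≤*)
import Data.Rational.Unnormalised.Properties as ℚᵘ
open import Data.Sum using (_⊎_; inj₁; inj₂)
open import Data.Vec using (Vec; []; _∷_; lookup; toList; here; there)
open import Data.Vec.Properties using (length-toList)
open import Function using (_∘_; id)
open import Relation.Binary.PropositionalEquality using (_≡_; refl; sym; trans; cong; cong₂; subst)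
open import Relation.Nullary using (¬_; Dec; yes; no; does)

private variable
  X Y : Set

-- Sums over lists

⟦_⟧ : Bool → ℕ
⟦ b ⟧ = if b then 1 else 0

∑ : List X → (X → ℕ) → ℕ
∑ xs f = sum (map f xs)

∑-mono : ∀ (xs : List X) {f g : X → ℕ} → (∀ x → f x ≤ g x) → ∑ xs f ≤ ∑ xs g
∑-mono []       f≤g = z≤n
∑-mono (x ∷ xs) f≤g = +-mono-≤ (f≤g x) (∑-mono xs f≤g)

∑-cong : ∀ (xs : List X) {f g : X → ℕ} → (∀ x → f x ≡ g x) → ∑ xs f ≡ ∑ xs g
∑-cong []       f≡g = refl
∑-cong (x ∷ xs) f≡g = cong₂ _+_ (f≡g x) (∑-cong xs f≡g)

∑-+ : ∀ (xs : List X) (f g : X → ℕ) → ∑ xs (λ x → f x + g x) ≡ ∑ xs f + ∑ xs g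
∑-+ []       f g = refl
∑-+ (x ∷ xs) f g rewrite ∑-+ xs f g =
  lemma (f x) (g x) (∑ xs f) (∑ xs g)
  where
  lemma : ∀ a b c d → a + b + (c + d) ≡ a + c + (b + d)
  lemma = solve-∀

∑-*ˡ : ∀ (xs : List X) c (f : X → ℕ) → ∑ xs (λ x → c * f x) ≡ c * ∑ xs f
∑-*ˡ []       c f = sym (*-zeroʳ c)
∑-*ˡ (x ∷ xs) c f rewrite ∑-*ˡ xs c f = sym (*-distribˡ-+ c (f x) (∑ xs f))

∑-const : ∀ (xs : List X) c → ∑ xs (λ _ → c) ≡ length xs * c
∑-const []       c = refl
∑-const (x ∷ xs) c = cong (c +_) (∑-const xs c)

∑-swap : ∀ (xs : List X) (ys : List Y) (f : X → Y → ℕ) →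
         ∑ xs (λ x → ∑ ys (f x)) ≡ ∑ ys (λ y → ∑ xs (λ x → f x y))
∑-swap []       ys f = sym (trans (∑-const ys 0) (*-zeroʳ (length ys)))
∑-swap (x ∷ xs) ys f rewrite ∑-swap xs ys f = sym (∑-+ ys (f x) _)

∑-++ : ∀ (xs ys : List X) (f : X → ℕ) → ∑ (xs ++ ys) f ≡ ∑ xs f + ∑ ys f
∑-++ xs ys f rewrite map-++ f xs ys = sum-++ (map f xs) (map f ys)

∑-map : ∀ (g : X → Y) (xs : List X) (f : Y → ℕ) → ∑ (map g xs) f ≡ ∑ xs (f ∘ g)
∑-map g []       f = refl
∑-map g (x ∷ xs) f = cong (f (g x) +_) (∑-map g xs f)

∑-concatMap : ∀ (g : X → List Y) (xs : List X) (f : Y → ℕ) →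
              ∑ (concatMap g xs) f ≡ ∑ xs (λ x → ∑ (g x) f)
∑-concatMap g []       f = refl
∑-concatMap g (x ∷ xs) f =
  trans (∑-++ (g x) (concatMap g xs) f) (cong (∑ (g x) f +_) (∑-concatMap g xs f))

-- With `m = 0` it turns a positive count into a witness; with a larger `m` it finds a value above
-- the average.
pigeonhole : ∀ (xs : List X) (f : X → ℕ) m → length xs * m < ∑ xs f → ∃ λ x → m < f x
pigeonhole (x ∷ xs) f m lt with m <? f x
... | yes m<fx = x , m<fx
... | no  m≮fx = pigeonhole xs f m
  (+-cancelˡ-< m _ _ (<-≤-trans lt (+-monoˡ-≤ (∑ xs f) (≮⇒≥ m≮fx))))

⟦⟧>0⇒true : ∀ {b} → 0 < ⟦ b ⟧ → b ≡ true
⟦⟧>0⇒true {true} _ = refl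

∧-true : ∀ {a b} → a ∧ b ≡ true → a ≡ true × b ≡ true
∧-true {true} {true} _ = refl , refl

not-true : ∀ {b} → not b ≡ true → b ≡ false
not-true {false} _ = refl

none : List (X → Bool) → X → Bool
none bs x = all (λ b → not (b x)) bs

-- Union bound: each test of `bs` removes at most `m` of the elements counted by `p`. The additive
-- form avoids truncated subtraction.
∑-avoid : ∀ (xs : List X) (p : X → Bool) m (bs : List (X → Bool)) →
          All (λ b → ∑ xs (λ x → ⟦ b x ⟧) ≤ m) bs →
          ∑ xs (λ x → ⟦ p x ⟧) ≤ ∑ xs (λ x → ⟦ p x ∧ none bs x ⟧) + length bs * m
∑-avoid xs p m [] [] = begin
  ∑ xs (λ x → ⟦ p x ⟧)              ≤⟨ ∑-mono xs (λ x → pointwise (p x)) ⟩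
  ∑ xs (λ x → ⟦ p x ∧ true ⟧)       ≤⟨ m≤m+n _ _ ⟩
  ∑ xs (λ x → ⟦ p x ∧ true ⟧) + 0   ∎
  where
  open ≤-Reasoning
  pointwise : ∀ a → ⟦ a ⟧ ≤ ⟦ a ∧ true ⟧
  pointwise true  = ≤-refl
  pointwise false = z≤n
∑-avoid xs p m (b ∷ bs) (b≤m ∷ bs≤m) = begin
  ∑ xs (λ x → ⟦ p x ⟧)
    ≤⟨ ∑-avoid xs p m bs bs≤m ⟩
  ∑ xs (λ x → ⟦ p x ∧ none bs x ⟧) + length bs * m
    ≤⟨ +-monoˡ-≤ _ (∑-mono xs (λ x → pointwise (p x) (b x) (none bs x))) ⟩
  ∑ xs (λ x → ⟦ p x ∧ none (b ∷ bs) x ⟧ + ⟦ b x ⟧) + length bs * m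
    ≡⟨ cong (_+ length bs * m) (∑-+ xs _ _) ⟩
  ∑ xs (λ x → ⟦ p x ∧ none (b ∷ bs) x ⟧) + ∑ xs (λ x → ⟦ b x ⟧) + length bs * m
    ≤⟨ +-monoˡ-≤ _ (+-monoʳ-≤ (∑ xs (λ x → ⟦ p x ∧ none (b ∷ bs) x ⟧)) b≤m) ⟩
  ∑ xs (λ x → ⟦ p x ∧ none (b ∷ bs) x ⟧) + m + length bs * m
    ≡⟨ +-assoc (∑ xs (λ x → ⟦ p x ∧ none (b ∷ bs) x ⟧)) m _ ⟩
  ∑ xs (λ x → ⟦ p x ∧ none (b ∷ bs) x ⟧) + (m + length bs * m) ∎
  where
  open ≤-Reasoning
  pointwise : ∀ a b c → ⟦ a ∧ c ⟧ ≤ ⟦ a ∧ (not b ∧ c) ⟧ + ⟦ b ⟧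
  pointwise false b     c     = z≤n
  pointwise true  false c     = m≤m+n _ _
  pointwise true  true  true  = ≤-refl
  pointwise true  true  false = z≤n

-- Subsets of Fin n

∑-∈ : ∀ {n} (p : Subset n) → ∑ (allFin n) (λ u → ⟦ lookup p u ⟧) ≡ ∣ p ∣
∑-∈ []      = refl
∑-∈ {suc n} (b ∷ p) = trans (cong (⟦ b ⟧ +_) tail) (head b)
  where
  tail : ∑ (tabulate Fin.suc) (λ u → ⟦ lookup (b ∷ p) u ⟧) ≡ ∣ p ∣
  tail = trans (cong sum (map-tabulate Fin.suc (λ u → ⟦ lookup (b ∷ p) u ⟧)))
         (trans (cong sum (sym (map-tabulate id (λ u → ⟦ lookup p u ⟧)))) (∑-∈ p))
  head : ∀ b → ⟦ b ⟧ + ∣ p ∣ ≡ ∣ b ∷ p ∣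
  head true  = refl
  head false = refl

∈⇒lookup : ∀ {n} {p : Subset n} {x} → x ∈ˢ p → lookup p x ≡ true
∈⇒lookup here        = refl
∈⇒lookup (there x∈p) = ∈⇒lookup x∈p

∣p∪⁅x⁆∣≤ : ∀ {n} (p : Subset n) x → ∣ p ∪ ⁅ x ⁆ ∣ ≤ suc ∣ p ∣
∣p∪⁅x⁆∣≤ (true  ∷ p) zero    rewrite ∪-identityʳ p = n≤1+n _
∣p∪⁅x⁆∣≤ (false ∷ p) zero    rewrite ∪-identityʳ p = ≤-refl
∣p∪⁅x⁆∣≤ (true  ∷ p) (suc x) = s≤s (∣p∪⁅x⁆∣≤ p x)
∣p∪⁅x⁆∣≤ (false ∷ p) (suc x) = ∣p∪⁅x⁆∣≤ p x

x∉p⇒∣p∪⁅x⁆∣ : ∀ {n} (p : Subset n) x → x ∉ˢ p → ∣ p ∪ ⁅ x ⁆ ∣ ≡ suc ∣ p ∣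
x∉p⇒∣p∪⁅x⁆∣ (true  ∷ p) zero    x∉p = ⊥-elim (x∉p here)
x∉p⇒∣p∪⁅x⁆∣ (false ∷ p) zero    x∉p rewrite ∪-identityʳ p = refl
x∉p⇒∣p∪⁅x⁆∣ (true  ∷ p) (suc x) x∉p = cong suc (x∉p⇒∣p∪⁅x⁆∣ p x (x∉p ∘ there))
x∉p⇒∣p∪⁅x⁆∣ (false ∷ p) (suc x) x∉p = x∉p⇒∣p∪⁅x⁆∣ p x (x∉p ∘ there)

∪⁅⁆⊆ : ∀ {n} {p q : Subset n} {x} → p ∪ ⁅ x ⁆ ⊆ˢ q → p ⊆ˢ q × x ∈ˢ q
∪⁅⁆⊆ {p = p} {x = x} h = (λ y∈p → h (p⊆p∪q ⁅ x ⁆ y∈p)) , h (q⊆p∪q p ⁅ x ⁆ (x∈⁅x⁆ x))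

∪⁅⁆⊆⁺ : ∀ {n} {p q : Subset n} {x} → p ⊆ˢ q → x ∈ˢ q → p ∪ ⁅ x ⁆ ⊆ˢ q
∪⁅⁆⊆⁺ {p = p} {x = x} p⊆q x∈q y∈ with x∈p∪q⁻ p ⁅ x ⁆ y∈
... | inj₁ y∈p = p⊆q y∈p
... | inj₂ y∈x rewrite x∈⁅y⁆⇒x≡y x y∈x = x∈q

-- Sets enter as vectors so that they can be built and counted one entry at a time; repetitions are
-- excluded by separate tests.
setOf : ∀ {n r} → Vec (Fin n) r → Subset n
setOf []      = ⊥
setOf (u ∷ us) = setOf us ∪ ⁅ u ⁆

-- Arranged so that prepending `u` creates only `⁅ u ⁆` and the sets `A ∪ ⁅ u ⁆` with `A` already
-- listed. These are the only sets whose saturation has to be examined when `u` is added.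
subsets⁺ : ∀ {n r} → Vec (Fin n) r → List (Subset n)
subsets⁺ []       = []
subsets⁺ (u ∷ us) = ⁅ u ⁆ ∷ subsets⁺ us ++ map (_∪ ⁅ u ⁆) (subsets⁺ us)

length-subsets⁺ : ∀ {n r} (us : Vec (Fin n) r) → suc (length (subsets⁺ us)) ≡ 2 ^ r
length-subsets⁺ [] = refl
length-subsets⁺ (u ∷ us)
  rewrite length-++ (subsets⁺ us) {map (_∪ ⁅ u ⁆) (subsets⁺ us)}
        | length-map (_∪ ⁅ u ⁆) (subsets⁺ us) | sym (length-subsets⁺ us) =
  lemma (length (subsets⁺ us))
  where
  lemma : ∀ a → suc (suc (a + a)) ≡ 2 * suc a
  lemma = solve-∀

x∉p-x : ∀ {n} (p : Subset n) x → x ∉ˢ p - x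
x∉p-x (_ ∷ p) zero    ()
x∉p-x (_ ∷ p) (suc x) (there h) = x∉p-x p x h

-- Either `A` avoids `u`, or `A - u` is nonempty and listed for `us`, or `A` is `⁅ u ⁆`. This passes
-- from the finitely many tests made during the construction to all nonempty subsets.
⊆⇒∈subsets⁺ : ∀ {n r} (us : Vec (Fin n) r) {A : Subset n} →
              Nonempty A → A ⊆ˢ setOf us → A ∈ subsets⁺ us
⊆⇒∈subsets⁺ [] (x , x∈A) A⊆ = ⊥-elim (∉⊥ (A⊆ x∈A))
⊆⇒∈subsets⁺ (u ∷ us) {A} A≢∅ A⊆ with u ∈? A
... | no u∉A = there (∈-++⁺ˡ (⊆⇒∈subsets⁺ us A≢∅ A⊆us))
  where
  A⊆us : A ⊆ˢ setOf us
  A⊆us x∈A with x∈p∪q⁻ (setOf us) ⁅ u ⁆ (A⊆ x∈A)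
  ... | inj₁ x∈ = x∈
  ... | inj₂ x∈u rewrite x∈⁅y⁆⇒x≡y u x∈u = ⊥-elim (u∉A x∈A)
... | yes u∈A with nonempty? (A - u)
...   | yes ne = there (∈-++⁺ʳ (subsets⁺ us) (subst (_∈ map (_∪ ⁅ u ⁆) (subsets⁺ us)) A-u∪u
                   (∈-map⁺ (_∪ ⁅ u ⁆) (⊆⇒∈subsets⁺ us ne A-u⊆us))))
  where
  A-u⊆us : A - u ⊆ˢ setOf us
  A-u⊆us {x} x∈ with x∈p∪q⁻ (setOf us) ⁅ u ⁆ (A⊆ (p─q⊆p A ⁅ u ⁆ x∈))
  ... | inj₁ x∈us = x∈us
  ... | inj₂ x∈u rewrite x∈⁅y⁆⇒x≡y u x∈u = ⊥-elim (x∉p-x A u x∈)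
  A⊆ₑ : A ⊆ˢ (A - u) ∪ ⁅ u ⁆
  A⊆ₑ {x} x∈A with x Fin.≟ u
  ... | yes refl = q⊆p∪q (A - u) ⁅ u ⁆ (x∈⁅x⁆ u)
  ... | no x≢u   = p⊆p∪q ⁅ u ⁆ (x∈p∧x≢y⇒x∈p-y x∈A x≢u)
  A-u∪u : (A - u) ∪ ⁅ u ⁆ ≡ A
  A-u∪u = ⊆-antisym (∪⁅⁆⊆⁺ (p─q⊆p A ⁅ u ⁆) u∈A) A⊆ₑ
...   | no ¬ne = here (⊆-antisym A⊆u (λ x∈u → subst (_∈ˢ A) (sym (x∈⁅y⁆⇒x≡y u x∈u)) u∈A))
  where
  A⊆u : A ⊆ˢ ⁅ u ⁆
  A⊆u {x} x∈A with x Fin.≟ u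
  ... | yes refl = x∈⁅x⁆ u
  ... | no x≢u   = ⊥-elim (¬ne (x , x∈p∧x≢y⇒x∈p-y x∈A x≢u))

dH-∷ : ∀ {n} (S T : Subset n) H A B →
       dH ((S , T) ∷ H) A B ≡ ⟦ does (A ⊆? S) ∧ does (B ⊆? T) ⟧ + dH H A B
dH-∷ S T H A B with does (A ⊆? S) ∧ does (B ⊆? T)
... | true  = refl
... | false = refl

-- Tuples of vertices

tuples : ∀ n r → List (Vec (Fin n) r)
tuples n zero    = [] ∷ []
tuples n (suc r) = concatMap (λ us → map (_∷ us) (allFin n)) (tuples n r)

∑-tuples : ∀ n r (f : Vec (Fin n) (suc r) → ℕ) →
           ∑ (tuples n (suc r)) f ≡ ∑ (tuples n r) (λ us → ∑ (allFin n) (λ u → f (u ∷ us)))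
∑-tuples n r f = trans (∑-concatMap _ (tuples n r) f)
  (∑-cong (tuples n r) (λ us → ∑-map (_∷ us) (allFin n) f))

length-allFin : ∀ n → length (allFin n) ≡ n
length-allFin n = length-tabulate id

length≡∑1 : ∀ (xs : List X) → length xs ≡ ∑ xs (λ _ → 1)
length≡∑1 xs = sym (trans (∑-const xs 1) (*-identityʳ _))

length-tuples : ∀ n r → length (tuples n r) ≡ n ^ r
length-tuples n zero    = refl
length-tuples n (suc r) = begin-equality
  length (tuples n (suc r))                          ≡⟨ length≡∑1 (tuples n (suc r)) ⟩
  ∑ (tuples n (suc r)) (λ _ → 1)                     ≡⟨ ∑-tuples n r _ ⟩
  ∑ (tuples n r) (λ _ → ∑ (allFin n) (λ _ → 1))      ≡⟨ ∑-cong (tuples n r) (λ _ → trans (sym (length≡∑1 (allFin n))) (length-allFin n)) ⟩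
  ∑ (tuples n r) (λ _ → n)                           ≡⟨ ∑-const (tuples n r) n ⟩
  length (tuples n r) * n                            ≡⟨ cong (_* n) (length-tuples n r) ⟩
  n ^ r * n                                          ≡⟨ *-comm (n ^ r) n ⟩
  n ^ suc r                                          ∎
  where open ≤-Reasoning

none⇒false : ∀ {X : Set} {bs : List (X → Bool)} {x b} → none bs x ≡ true → b ∈ bs → b x ≡ false
none⇒false eq (here refl) = not-true (proj₁ (∧-true eq))
none⇒false {bs = _ ∷ _} eq (there b∈) = none⇒false (proj₂ (∧-true eq)) b∈

-- If `A ∪ ⁅ u ⁆` lies in `S`, then so does `A`, and `u` is one of the `∣ S ∣` elements of `S`. The
-- Boolean `b` carries the condition on the other side of the pair.
∑-⊆-∪⁅⁆ : ∀ {n} (A S : Subset n) b →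
          ∑ (allFin n) (λ u → ⟦ does (A ∪ ⁅ u ⁆ ⊆? S) ∧ b ⟧) ≤ ∣ S ∣ * ⟦ does (A ⊆? S) ∧ b ⟧
∑-⊆-∪⁅⁆ {n} A S b = begin
  ∑ (allFin n) (λ u → ⟦ does (A ∪ ⁅ u ⁆ ⊆? S) ∧ b ⟧)                ≤⟨ ∑-mono (allFin n) pointwise ⟩
  ∑ (allFin n) (λ u → ⟦ does (A ⊆? S) ∧ b ⟧ * ⟦ lookup S u ⟧)       ≡⟨ ∑-*ˡ (allFin n) ⟦ does (A ⊆? S) ∧ b ⟧ (λ u → ⟦ lookup S u ⟧) ⟩
  ⟦ does (A ⊆? S) ∧ b ⟧ * ∑ (allFin n) (λ u → ⟦ lookup S u ⟧)       ≡⟨ cong (⟦ does (A ⊆? S) ∧ b ⟧ *_) (∑-∈ S) ⟩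
  ⟦ does (A ⊆? S) ∧ b ⟧ * ∣ S ∣                                     ≡⟨ *-comm _ ∣ S ∣ ⟩
  ∣ S ∣ * ⟦ does (A ⊆? S) ∧ b ⟧                                     ∎
  where
  open ≤-Reasoning
  pointwise : ∀ u → ⟦ does (A ∪ ⁅ u ⁆ ⊆? S) ∧ b ⟧ ≤ ⟦ does (A ⊆? S) ∧ b ⟧ * ⟦ lookup S u ⟧
  pointwise u with A ∪ ⁅ u ⁆ ⊆? S | A ⊆? S
  ... | no _  | _      = z≤n
  ... | yes h | no A⊈S = ⊥-elim (A⊈S (proj₁ (∪⁅⁆⊆ h)))
  ... | yes h | yes _ rewrite ∈⇒lookup (proj₂ (∪⁅⁆⊆ {p = A} h)) = ≤-reflexive (sym (*-identityʳ ⟦ b ⟧))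

-- Double counting of codegrees

HasSizes : ∀ {n} → ℕ → ℕ → Subset n × Subset n → Set
HasSizes s t (S , T) = ∣ S ∣ ≡ s × ∣ T ∣ ≡ t

module _ {n s t : ℕ} where

  -- A pair `(S , T)` contributes to the left side only if it is counted by `dH H A B`, and then
  -- once for each `u` in `S`.
  ∑-dHˡ : ∀ {H : List (Subset n × Subset n)} → All (HasSizes s t) H → ∀ A B →
          ∑ (allFin n) (λ u → dH H (A ∪ ⁅ u ⁆) B) ≤ s * dH H A B
  ∑-dHˡ [] A B = ≤-reflexive (trans (∑-const (allFin n) 0) (trans (*-zeroʳ (length (allFin n))) (sym (*-zeroʳ s))))
  ∑-dHˡ {(S , T) ∷ H} ((refl , _) ∷ sizes) A B = begin
    ∑ (allFin n) (λ u → dH ((S , T) ∷ H) (A ∪ ⁅ u ⁆) B)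
      ≡⟨ ∑-cong (allFin n) (λ u → dH-∷ S T H (A ∪ ⁅ u ⁆) B) ⟩
    ∑ (allFin n) (λ u → ⟦ does (A ∪ ⁅ u ⁆ ⊆? S) ∧ does (B ⊆? T) ⟧ + dH H (A ∪ ⁅ u ⁆) B)
      ≡⟨ ∑-+ (allFin n) _ _ ⟩
    ∑ (allFin n) (λ u → ⟦ does (A ∪ ⁅ u ⁆ ⊆? S) ∧ does (B ⊆? T) ⟧) + ∑ (allFin n) (λ u → dH H (A ∪ ⁅ u ⁆) B)
      ≤⟨ +-mono-≤ (∑-⊆-∪⁅⁆ A S _) (∑-dHˡ sizes A B) ⟩
    s * ⟦ does (A ⊆? S) ∧ does (B ⊆? T) ⟧ + s * dH H A B
      ≡⟨ *-distribˡ-+ s _ _ ⟨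
    s * (⟦ does (A ⊆? S) ∧ does (B ⊆? T) ⟧ + dH H A B)
      ≡⟨ cong (s *_) (dH-∷ S T H A B) ⟨
    s * dH ((S , T) ∷ H) A B ∎
    where open ≤-Reasoning

  ∑-dHʳ : ∀ {H : List (Subset n × Subset n)} → All (HasSizes s t) H → ∀ A B →
          ∑ (allFin n) (λ v → dH H A (B ∪ ⁅ v ⁆)) ≤ t * dH H A B
  ∑-dHʳ [] A B = ≤-reflexive (trans (∑-const (allFin n) 0) (trans (*-zeroʳ (length (allFin n))) (sym (*-zeroʳ t))))
  ∑-dHʳ {(S , T) ∷ H} ((_ , refl) ∷ sizes) A B = begin
    ∑ (allFin n) (λ v → dH ((S , T) ∷ H) A (B ∪ ⁅ v ⁆))
      -- The conjunction is flipped so that `∑-⊆-∪⁅⁆` applies to the second component.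
      ≡⟨ ∑-cong (allFin n) (λ v → trans (dH-∷ S T H A (B ∪ ⁅ v ⁆))
           (cong (λ b → ⟦ b ⟧ + dH H A (B ∪ ⁅ v ⁆)) (∧-comm (does (A ⊆? S)) _))) ⟩
    ∑ (allFin n) (λ v → ⟦ does (B ∪ ⁅ v ⁆ ⊆? T) ∧ does (A ⊆? S) ⟧ + dH H A (B ∪ ⁅ v ⁆))
      ≡⟨ ∑-+ (allFin n) _ _ ⟩
    ∑ (allFin n) (λ v → ⟦ does (B ∪ ⁅ v ⁆ ⊆? T) ∧ does (A ⊆? S) ⟧) + ∑ (allFin n) (λ v → dH H A (B ∪ ⁅ v ⁆))
      ≤⟨ +-mono-≤ (∑-⊆-∪⁅⁆ B T _) (∑-dHʳ sizes A B) ⟩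
    t * ⟦ does (B ⊆? T) ∧ does (A ⊆? S) ⟧ + t * dH H A B
      ≡⟨ *-distribˡ-+ t _ _ ⟨
    t * (⟦ does (B ⊆? T) ∧ does (A ⊆? S) ⟧ + dH H A B)
      ≡⟨ cong (λ b → t * (⟦ b ⟧ + dH H A B)) (∧-comm (does (B ⊆? T)) _) ⟩
    t * (⟦ does (A ⊆? S) ∧ does (B ⊆? T) ⟧ + dH H A B)
      ≡⟨ cong (t *_) (dH-∷ S T H A B) ⟨
    t * dH ((S , T) ∷ H) A B ∎
    where open ≤-Reasoning

-- An equality for `i < s`. For `i ≥ s` truncation makes both exponents zero, and `m ≥ 1` is used
-- instead.
^-∸-step : ∀ m .{{_ : NonZero m}} s i → m ^ (s ∸ i) ≤ m * m ^ (s ∸ suc i)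
^-∸-step m zero    zero    = ≤-trans (>-nonZero⁻¹ m) (≤-reflexive (sym (*-identityʳ m)))
^-∸-step m zero    (suc i) = ≤-trans (>-nonZero⁻¹ m) (≤-reflexive (sym (*-identityʳ m)))
^-∸-step m (suc s) zero    = ≤-refl
^-∸-step m (suc s) (suc i) = ^-∸-step m s i

-- Replaces convexity when Σ_v d(v)ˢ is bounded below by the number of edges.
shifted-power : ∀ d L s → L ^ s * d ≤ (d ∸ L) ^ suc s + 2 * L ^ suc s
shifted-power d L s with ≤-total d (2 * L)
... | inj₁ d≤2L = begin
  L ^ s * d                             ≤⟨ *-monoʳ-≤ (L ^ s) d≤2L ⟩
  L ^ s * (2 * L)                       ≡⟨ lemma (L ^ s) L ⟩
  2 * (L * L ^ s)                       ≤⟨ m≤n+m _ ((d ∸ L) ^ suc s) ⟩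
  (d ∸ L) ^ suc s + 2 * L ^ suc s       ∎
  where
  open ≤-Reasoning
  lemma : ∀ a b → a * (2 * b) ≡ 2 * (b * a)
  lemma = solve-∀
... | inj₂ 2L≤d = begin
  L ^ s * d                             ≡⟨ cong (L ^ s *_) (m+[n∸m]≡n L≤d) ⟨
  L ^ s * (L + (d ∸ L))                 ≡⟨ lemma (L ^ s) L (d ∸ L) ⟩
  (d ∸ L) * L ^ s + L * L ^ s           ≤⟨ +-mono-≤ (*-monoʳ-≤ (d ∸ L) (^-monoˡ-≤ s L≤d∸L)) (m≤n*m _ 2) ⟩
  (d ∸ L) ^ suc s + 2 * L ^ suc s       ∎
  where
  open ≤-Reasoning
  lemma : ∀ a b c → a * (b + c) ≡ c * a + b * a
  lemma = solve-∀
  L+L≤d : L + L ≤ d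
  L+L≤d = subst (λ x → L + x ≤ d) (+-identityʳ L) 2L≤d
  L≤d : L ≤ d
  L≤d = ≤-trans (m≤m+n L L) L+L≤d
  L≤d∸L : L ≤ d ∸ L
  L≤d∸L = +-cancelˡ-≤ L _ _ (≤-trans L+L≤d (≤-reflexive (sym (m+[n∸m]≡n L≤d))))

length-cartesianProductWith : ∀ {X Y Z : Set} (f : X → Y → Z) xs ys →
                              length (cartesianProductWith f xs ys) ≡ length xs * length ys
length-cartesianProductWith f []       ys = refl
length-cartesianProductWith f (x ∷ xs) ys =
  trans (length-++ (map (f x) ys))
        (cong₂ _+_ (length-map (f x) ys) (length-cartesianProductWith f xs ys))

-- Repetition is phrased as a list of Boolean tests so that the same union bound handles it together
-- with saturation.
≟-tests : ∀ {n r} → Vec (Fin n) r → List (Fin n → Bool)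
≟-tests us = map (λ w u → does (u Fin.≟ w)) (toList us)

∑-≟ : ∀ {n} (w : Fin n) → ∑ (allFin n) (λ u → ⟦ does (u Fin.≟ w) ⟧) ≤ 1
∑-≟ {n} w = begin
  ∑ (allFin n) (λ u → ⟦ does (u Fin.≟ w) ⟧)    ≤⟨ ∑-mono (allFin n) pointwise ⟩
  ∑ (allFin n) (λ u → ⟦ lookup ⁅ w ⁆ u ⟧)      ≡⟨ ∑-∈ ⁅ w ⁆ ⟩
  ∣ ⁅ w ⁆ ∣                                    ≡⟨ ∣⁅x⁆∣≡1 w ⟩
  1                                            ∎
  where
  open ≤-Reasoning
  pointwise : ∀ u → ⟦ does (u Fin.≟ w) ⟧ ≤ ⟦ lookup ⁅ w ⁆ u ⟧
  pointwise u with u Fin.≟ w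
  ... | yes refl rewrite ∈⇒lookup (x∈⁅x⁆ u) = ≤-refl
  ... | no _ = z≤n

≟-tests⇒∉ : ∀ {n r} (us : Vec (Fin n) r) {u} →
            (∀ {b} → b ∈ ≟-tests us → b u ≡ false) → u ∉ˢ setOf us
≟-tests⇒∉ []       _ u∈ = ∉⊥ u∈
≟-tests⇒∉ (w ∷ us) {u} h u∈ with x∈p∪q⁻ (setOf us) ⁅ w ⁆ u∈
... | inj₁ u∈us = ≟-tests⇒∉ us (h ∘ there) u∈us
... | inj₂ u∈w with u Fin.≟ w | h (here refl)
...   | no u≢w | _ = u≢w (x∈⁅y⁆⇒x≡y w u∈w)

-- At most blockedˡ s * M vertices are excluded when a good tuple is extended on the S-side,
-- and at most blockedʳ s t * Q on the T-side.
blockedˡ : ℕ → ℕ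
blockedˡ s = (s + 2 ^ s) * s

blockedʳ : ℕ → ℕ → ℕ
blockedʳ s t = (t + 2 ^ s * 2 ^ t) * t

-- The positive integers M and Q play the roles of δ k n^((s-1)/s) and δ k^s.
module Saturation (s′ t′ M Q : ℕ) .{{M≢0 : NonZero M}} .{{Q≢0 : NonZero Q}} where

  s t : ℕ
  s = suc s′
  t = suc t′

  L P : ℕ
  L = blockedˡ s * M
  P = blockedʳ s t

  D : ℕ → ℕ → ℕ
  D i j = M ^ (s ∸ i) * Q ^ (t ∸ j)

  D≢0 : ∀ i j → NonZero (D i j)
  D≢0 i j = m*n≢0 _ _ {{m^n≢0 M (s ∸ i) {{M≢0}}}} {{m^n≢0 Q (t ∸ j) {{Q≢0}}}}

  D-stepˡ : ∀ i j → D i j ≤ M * D (suc i) j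
  D-stepˡ i j = ≤-trans (*-monoˡ-≤ _ (^-∸-step M {{M≢0}} s i)) (≤-reflexive (*-assoc M _ _))

  D-stepʳ : ∀ i j → D i j ≤ Q * D i (suc j)
  D-stepʳ i j = ≤-trans (*-monoʳ-≤ (M ^ (s ∸ i)) (^-∸-step Q {{Q≢0}} t j)) (≤-reflexive (lemma (M ^ (s ∸ i)) Q _))
    where
    lemma : ∀ a b c → a * (b * c) ≡ b * (a * c)
    lemma = solve-∀

  D-antimonoˡ : ∀ {i i′} j → i ≤ i′ → D i′ j ≤ D i j
  D-antimonoˡ j i≤i′ = *-monoˡ-≤ _ (^-monoʳ-≤ M {{M≢0}} (∸-monoʳ-≤ s i≤i′))

  D-antimonoʳ : ∀ i {j j′} → j ≤ j′ → D i j′ ≤ D i j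
  D-antimonoʳ i j≤j′ = *-monoʳ-≤ (M ^ (s ∸ i)) (^-monoʳ-≤ Q {{Q≢0}} (∸-monoʳ-≤ t j≤j′))

  module _ {n} (H : List (Subset n × Subset n)) where

    -- Equality already counts as saturated, so an unsaturated pair can gain one more member of `H`
    -- and still satisfy the codegree bound.
    saturated : Subset n → Subset n → Bool
    saturated A B = D ∣ A ∣ ∣ B ∣ ≤ᵇ dH H A B

    Unsaturated : Subset n → Subset n → Set
    Unsaturated A B = dH H A B < D ∣ A ∣ ∣ B ∣

    ¬saturated⇒ : ∀ {A B} → saturated A B ≡ false → Unsaturated A B
    ¬saturated⇒ eq = ≰⇒> λ le → subst T eq (≤⇒≤ᵇ le)

    -- The pointwise step of Markov's inequality. Sizes are only bounded above because `A ∪ ⁅ u ⁆`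
    -- does not grow when `u` is already in `A`; `D` is antitone, so the threshold only increases.
    saturated-weight : ∀ A B {i j} → ∣ A ∣ ≤ i → ∣ B ∣ ≤ j → ⟦ saturated A B ⟧ * D i j ≤ dH H A B
    saturated-weight A B {i} {j} A≤i B≤j with saturated A B in eq
    ... | false = z≤n
    ... | true  = begin
      D i j + 0          ≡⟨ +-identityʳ _ ⟩
      D i j              ≤⟨ D-antimonoˡ j A≤i ⟩
      D (∣ A ∣) j        ≤⟨ D-antimonoʳ (∣ A ∣) B≤j ⟩
      D (∣ A ∣) (∣ B ∣)  ≤⟨ ≤ᵇ⇒≤ _ _ (subst T (sym eq) _) ⟩
      dH H A B           ∎
      where open ≤-Reasoning

    module _ (sizes : All (HasSizes s t) H) where

      -- Markov's inequality: each saturated extension has codegree at least `D (suc ∣ A ∣) ∣ B ∣`,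
      -- while by `∑-dHˡ` all extensions together have at most `s * dH H A B`, which `D-stepˡ`
      -- bounds by `s * M` times that threshold.
      few-saturatedˡ : ∀ {A B} → Unsaturated A B →
                       ∑ (allFin n) (λ u → ⟦ saturated (A ∪ ⁅ u ⁆) B ⟧) ≤ s * M
      few-saturatedˡ {A} {B} unsat =
        *-cancelʳ-≤ _ _ (D (suc ∣ A ∣) ∣ B ∣) {{D≢0 (suc ∣ A ∣) ∣ B ∣}} (begin
        ∑ (allFin n) (λ u → ⟦ saturated (A ∪ ⁅ u ⁆) B ⟧) * D₁
          ≡⟨ *-comm _ D₁ ⟩
        D₁ * ∑ (allFin n) (λ u → ⟦ saturated (A ∪ ⁅ u ⁆) B ⟧)
          ≡⟨ ∑-*ˡ (allFin n) D₁ _ ⟨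
        ∑ (allFin n) (λ u → D₁ * ⟦ saturated (A ∪ ⁅ u ⁆) B ⟧)
          ≤⟨ ∑-mono (allFin n) (λ u → ≤-trans (≤-reflexive (*-comm D₁ _))
               (saturated-weight (A ∪ ⁅ u ⁆) B (∣p∪⁅x⁆∣≤ A u) ≤-refl)) ⟩
        ∑ (allFin n) (λ u → dH H (A ∪ ⁅ u ⁆) B)
          ≤⟨ ∑-dHˡ sizes A B ⟩
        s * dH H A B
          ≤⟨ *-monoʳ-≤ s (≤-trans (<⇒≤ unsat) (D-stepˡ ∣ A ∣ ∣ B ∣)) ⟩
        s * (M * D₁)
          ≡⟨ *-assoc s M D₁ ⟨
        s * M * D₁ ∎)
        where
        open ≤-Reasoning
        D₁ = D (suc ∣ A ∣) ∣ B ∣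

      few-saturatedʳ : ∀ {A B} → Unsaturated A B →
                       ∑ (allFin n) (λ v → ⟦ saturated A (B ∪ ⁅ v ⁆) ⟧) ≤ t * Q
      few-saturatedʳ {A} {B} unsat =
        *-cancelʳ-≤ _ _ (D ∣ A ∣ (suc ∣ B ∣)) {{D≢0 ∣ A ∣ (suc ∣ B ∣)}} (begin
        ∑ (allFin n) (λ v → ⟦ saturated A (B ∪ ⁅ v ⁆) ⟧) * D₁
          ≡⟨ *-comm _ D₁ ⟩
        D₁ * ∑ (allFin n) (λ v → ⟦ saturated A (B ∪ ⁅ v ⁆) ⟧)
          ≡⟨ ∑-*ˡ (allFin n) D₁ _ ⟨
        ∑ (allFin n) (λ v → D₁ * ⟦ saturated A (B ∪ ⁅ v ⁆) ⟧)
          ≤⟨ ∑-mono (allFin n) (λ v → ≤-trans (≤-reflexive (*-comm D₁ _))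
               (saturated-weight A (B ∪ ⁅ v ⁆) ≤-refl (∣p∪⁅x⁆∣≤ B v))) ⟩
        ∑ (allFin n) (λ v → dH H A (B ∪ ⁅ v ⁆))
          ≤⟨ ∑-dHʳ sizes A B ⟩
        t * dH H A B
          ≤⟨ *-monoʳ-≤ t (≤-trans (<⇒≤ unsat) (D-stepʳ ∣ A ∣ ∣ B ∣)) ⟩
        t * (Q * D₁)
          ≡⟨ *-assoc t Q D₁ ⟨
        t * Q * D₁ ∎)
        where
        open ≤-Reasoning
        D₁ = D ∣ A ∣ (suc ∣ B ∣)

      -- Both double counts are applied in turn, starting from `(⊥ , ⊥)`, whose codegree is at most
      -- `length H`; Markov's inequality with threshold `D 1 1` then counts the saturated ordered
      -- pairs.
      few-saturated-edges :
        ∑ (allFin n) (λ u → ∑ (allFin n) (λ v → ⟦ saturated ⁅ u ⁆ ⁅ v ⁆ ⟧)) * D 1 1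
          ≤ s * t * length H
      few-saturated-edges = begin
        ∑ V (λ u → ∑ V (λ v → ⟦ saturated ⁅ u ⁆ ⁅ v ⁆ ⟧)) * D 1 1
          ≡⟨ *-comm _ (D 1 1) ⟩
        D 1 1 * ∑ V (λ u → ∑ V (λ v → ⟦ saturated ⁅ u ⁆ ⁅ v ⁆ ⟧))
          ≡⟨ ∑-*ˡ V (D 1 1) _ ⟨
        ∑ V (λ u → D 1 1 * ∑ V (λ v → ⟦ saturated ⁅ u ⁆ ⁅ v ⁆ ⟧))
          ≡⟨ ∑-cong V (λ u → ∑-*ˡ V (D 1 1) (λ v → ⟦ saturated ⁅ u ⁆ ⁅ v ⁆ ⟧)) ⟨
        ∑ V (λ u → ∑ V (λ v → D 1 1 * ⟦ saturated ⁅ u ⁆ ⁅ v ⁆ ⟧))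
          ≤⟨ ∑-mono V (λ u → ∑-mono V (pointwise u)) ⟩
        ∑ V (λ u → ∑ V (λ v → dH H (⊥ ∪ ⁅ u ⁆) (⊥ ∪ ⁅ v ⁆)))
          ≤⟨ ∑-mono V (λ u → ∑-dHʳ sizes (⊥ ∪ ⁅ u ⁆) ⊥) ⟩
        ∑ V (λ u → t * dH H (⊥ ∪ ⁅ u ⁆) ⊥)
          ≡⟨ ∑-*ˡ V t _ ⟩
        t * ∑ V (λ u → dH H (⊥ ∪ ⁅ u ⁆) ⊥)
          ≤⟨ *-monoʳ-≤ t (∑-dHˡ sizes ⊥ ⊥) ⟩
        t * (s * dH H ⊥ ⊥)
          ≤⟨ *-monoʳ-≤ t (*-monoʳ-≤ s (length-filter _ H)) ⟩
        t * (s * length H)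
          ≡⟨ lemma t s (length H) ⟩
        s * t * length H ∎
        where
        open ≤-Reasoning
        V = allFin n
        lemma : ∀ a b c → a * (b * c) ≡ b * a * c
        lemma = solve-∀
        pointwise : ∀ u v → D 1 1 * ⟦ saturated ⁅ u ⁆ ⁅ v ⁆ ⟧ ≤ dH H (⊥ ∪ ⁅ u ⁆) (⊥ ∪ ⁅ v ⁆)
        pointwise u v rewrite ∪-identityˡ ⁅ u ⁆ | ∪-identityˡ ⁅ v ⁆ =
          ≤-trans (≤-reflexive (*-comm (D 1 1) _))
            (saturated-weight ⁅ u ⁆ ⁅ v ⁆ (≤-reflexive (∣⁅x⁆∣≡1 u)) (≤-reflexive (∣⁅x⁆∣≡1 v)))

-- Finding a new pair

edges≤∑ : ∀ {n} (G : Graph n) → edges G ≤ ∑ (allFin n) (λ u → ∑ (allFin n) (λ v → ⟦ Adj G u v ⟧))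
edges≤∑ {n} G = ∑-mono (allFin n) λ u → ∑-mono (allFin n) λ v → pointwise (toℕ u <ᵇ toℕ v) (Adj G u v)
  where
  pointwise : ∀ a b → ⟦ a ∧ b ⟧ ≤ ⟦ b ⟧
  pointwise true  b = ≤-refl
  pointwise false b = z≤n

length-subsets⁺≤ : ∀ {n r m} (us : Vec (Fin n) r) → r ≤ m → length (subsets⁺ us) ≤ 2 ^ m
length-subsets⁺≤ {r = r} {m} us r≤m = begin
  length (subsets⁺ us)           ≤⟨ n≤1+n _ ⟩
  suc (length (subsets⁺ us))     ≡⟨ length-subsets⁺ us ⟩
  2 ^ r                          ≤⟨ ^-monoʳ-≤ 2 r≤m ⟩
  2 ^ m                          ∎
  where open ≤-Reasoning

module Augmentation {n : ℕ} (G : Graph n) (s′ t′ M Q : ℕ) .{{M≢0 : NonZero M}} .{{Q≢0 : NonZero Q}}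
  (H : List (Subset n × Subset n)) (sizes : All (HasSizes (suc s′) (suc t′)) H) where

  open Saturation s′ t′ M Q

  V : List (Fin n)
  V = allFin n

  sat : Subset n → Subset n → Bool
  sat = saturated H

  Unsat : Subset n → Subset n → Set
  Unsat = Unsaturated H

  -- Good tuples of neighbours

  usable : Fin n → Fin n → Bool
  usable v u = Adj G u v ∧ not (sat ⁅ u ⁆ ⁅ v ⁆)

  usable⇒ : ∀ {v u} → usable v u ≡ true → Adj G u v ≡ true × Unsat ⁅ u ⁆ ⁅ v ⁆
  usable⇒ {v} {u} eq with ∧-true {Adj G u v} eq
  ... | adj , ¬sat = adj , ¬saturated⇒ H (not-true ¬sat)

  -- The new entry must differ from the old ones and must not saturate any enlarged set `A ∪ ⁅ u ⁆`;
  -- the singleton `⁅ u ⁆` is taken care of by `usable`.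
  bad : ∀ {r} → Fin n → Vec (Fin n) r → List (Fin n → Bool)
  bad v us = ≟-tests us ++ map (λ A u → sat (A ∪ ⁅ u ⁆) ⁅ v ⁆) (subsets⁺ us)

  good : ∀ {r} → Fin n → Vec (Fin n) r → Bool
  good v []       = true
  good v (u ∷ us) = good v us ∧ (usable v u ∧ none (bad v us) u)

  good⇒distinct : ∀ {r} v (us : Vec (Fin n) r) → good v us ≡ true → ∣ setOf us ∣ ≡ r
  good⇒distinct v []       _ = ∣⊥∣≡0 n
  good⇒distinct v (u ∷ us) g with ∧-true g
  ... | g-us , g-u = trans (x∉p⇒∣p∪⁅x⁆∣ (setOf us) u
      (≟-tests⇒∉ us (λ b∈ → none⇒false (proj₂ (∧-true g-u)) (∈-++⁺ˡ b∈))))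
    (cong suc (good⇒distinct v us g-us))

  good⇒adjacent : ∀ {r} v (us : Vec (Fin n) r) → good v us ≡ true →
                  ∀ {u} → u ∈ˢ setOf us → Adj G u v ≡ true
  good⇒adjacent v []       _ u∈ = ⊥-elim (∉⊥ u∈)
  good⇒adjacent v (w ∷ us) g {u} u∈ with ∧-true g | x∈p∪q⁻ (setOf us) ⁅ w ⁆ u∈
  ... | g-us , _   | inj₁ u∈us = good⇒adjacent v us g-us u∈us
  ... | _    , g-w | inj₂ u∈w rewrite x∈⁅y⁆⇒x≡y w u∈w = proj₁ (usable⇒ (proj₁ (∧-true g-w)))

  good⇒unsaturated : ∀ {r} v (us : Vec (Fin n) r) → good v us ≡ true →
                     ∀ {A} → A ∈ subsets⁺ us → Unsat A ⁅ v ⁆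
  good⇒unsaturated v (u ∷ us) g A∈ with ∧-true {good v us} {usable v u ∧ none (bad v us) u} g
  good⇒unsaturated v (u ∷ us) g (here refl) | _ , g-u =
    proj₂ (usable⇒ (proj₁ (∧-true g-u)))
  good⇒unsaturated v (u ∷ us) g (there A∈) | g-us , g-u with ∈-++⁻ (subsets⁺ us) A∈
  ... | inj₁ A∈us = good⇒unsaturated v us g-us A∈us
  ... | inj₂ A∈map with ∈-map⁻ (_∪ ⁅ u ⁆) A∈map
  ...   | A′ , A′∈ , refl = ¬saturated⇒ H (none⇒false (proj₂ (∧-true g-u))
            (∈-++⁺ʳ (≟-tests us) (∈-map⁺ (λ A u → sat (A ∪ ⁅ u ⁆) ⁅ v ⁆) A′∈)))

  usableDegree : Fin n → ℕ
  usableDegree v = ∑ V (λ u → ⟦ usable v u ⟧)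

  ∑-≟-tests : ∀ {r m} (us : Vec (Fin n) r) → 1 ≤ m → ∀ {b} → b ∈ ≟-tests us → ∑ V (λ u → ⟦ b u ⟧) ≤ m
  ∑-≟-tests us 1≤m b∈ with ∈-map⁻ (λ w u → does (u Fin.≟ w)) b∈
  ... | w , _ , refl = ≤-trans (∑-≟ w) 1≤m

  length-≟-tests : ∀ {r} (us : Vec (Fin n) r) → length (≟-tests us) ≡ r
  length-≟-tests us = trans (length-map _ (toList us)) (length-toList us)

  -- There are at most `s` repetition tests and `2 ^ s` saturation tests. Goodness of `us` makes
  -- each listed `A` unsaturated with `⁅ v ⁆`, so `few-saturatedˡ` bounds every saturation test by
  -- `s * M`.
  extensions : ∀ {r} v (us : Vec (Fin n) r) → r ≤ s → good v us ≡ true →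
               usableDegree v ≤ ∑ V (λ u → ⟦ usable v u ∧ none (bad v us) u ⟧) + L
  extensions {r} v us r≤s g = begin
    usableDegree v
      ≤⟨ ∑-avoid V (usable v) (s * M) (bad v us) (All.tabulate few) ⟩
    ∑ V (λ u → ⟦ usable v u ∧ none (bad v us) u ⟧) + length (bad v us) * (s * M)
      ≤⟨ +-monoʳ-≤ _ (*-monoˡ-≤ (s * M) length-bad) ⟩
    ∑ V (λ u → ⟦ usable v u ∧ none (bad v us) u ⟧) + (s + 2 ^ s) * (s * M)
      ≡⟨ cong (∑ V (λ u → ⟦ usable v u ∧ none (bad v us) u ⟧) +_) (*-assoc (s + 2 ^ s) s M) ⟨
    ∑ V (λ u → ⟦ usable v u ∧ none (bad v us) u ⟧) + L ∎
    where
    open ≤-Reasoning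
    few : ∀ {b} → b ∈ bad v us → ∑ V (λ u → ⟦ b u ⟧) ≤ s * M
    few b∈ with ∈-++⁻ (≟-tests us) b∈
    -- A repetition test has at most one hit; `M ≥ 1` lets it share the bound of the saturation
    -- tests.
    ... | inj₁ b∈≟ = ∑-≟-tests us (≤-trans (>-nonZero⁻¹ M) (m≤n*m M s)) b∈≟
    ... | inj₂ b∈sat with ∈-map⁻ (λ A u → sat (A ∪ ⁅ u ⁆) ⁅ v ⁆) b∈sat
    ...   | A , A∈ , refl = few-saturatedˡ H sizes (good⇒unsaturated v us g A∈)
    length-bad : length (bad v us) ≤ s + 2 ^ s
    length-bad = ≤-trans
      (≤-reflexive (trans (length-++ (≟-tests us)) (cong₂ _+_ (length-≟-tests us) (length-map _ (subsets⁺ us)))))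
      (+-mono-≤ r≤s (length-subsets⁺≤ us r≤s))

  -- Each good tuple of fewer than `s` entries extends in at least `usableDegree v ∸ L` ways.
  -- Truncation makes the bound trivial for positive `r` at vertices of small usable degree.
  many-good-tuples : ∀ v r → r ≤ s → (usableDegree v ∸ L) ^ r ≤ ∑ (tuples n r) (λ us → ⟦ good v us ⟧)
  many-good-tuples v zero    _   = ≤-refl
  many-good-tuples v (suc r) r<s = begin
    d * d ^ r
      ≤⟨ *-monoʳ-≤ d (many-good-tuples v r (<⇒≤ r<s)) ⟩
    d * ∑ (tuples n r) (λ us → ⟦ good v us ⟧)
      ≡⟨ ∑-*ˡ (tuples n r) d _ ⟨
    ∑ (tuples n r) (λ us → d * ⟦ good v us ⟧)
      ≤⟨ ∑-mono (tuples n r) pointwise ⟩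
    ∑ (tuples n r) (λ us → ∑ V (λ u → ⟦ good v (u ∷ us) ⟧))
      ≡⟨ ∑-tuples n r (λ us → ⟦ good v us ⟧) ⟨
    ∑ (tuples n (suc r)) (λ us → ⟦ good v us ⟧) ∎
    where
    open ≤-Reasoning
    d = usableDegree v ∸ L
    pointwise : ∀ us → d * ⟦ good v us ⟧ ≤ ∑ V (λ u → ⟦ good v (u ∷ us) ⟧)
    pointwise us with good v us in eq
    ... | false rewrite *-zeroʳ d = z≤n
    ... | true  rewrite *-identityʳ d =
      m≤n+o⇒m∸n≤o (usableDegree v) L (≤-trans (extensions v us (<⇒≤ r<s) eq)
        (≤-reflexive (+-comm _ L)))

  module _ .{{n≢0 : NonZero n}}
    (H-small : 2 * (s * t * length H) < edges G * D 1 1)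
    (e-large : 8 * n * L ≤ edges G) where

    L≢0 : NonZero L
    L≢0 = m*n≢0 (blockedˡ s) M {{m*n≢0 (s + 2 ^ s) s}} {{M≢0}}

    -- Every adjacent pair is usable or saturated, and `H-small` forces the number `σ` of saturated
    -- ordered pairs below half of `edges G`.
    half-usable : edges G ≤ 2 * ∑ V usableDegree
    half-usable = +-cancelʳ-≤ (edges G) _ _ (begin
      edges G + edges G                                ≤⟨ +-mono-≤ e≤ e≤ ⟩
      (U + σ) + (U + σ)                                ≡⟨ lemma U σ ⟩
      2 * U + 2 * σ                                    ≤⟨ +-monoʳ-≤ (2 * U) (<⇒≤ 2σ<e) ⟩
      2 * U + edges G                                  ∎)
      where
      open ≤-Reasoning
      U = ∑ V usableDegree
      σ = ∑ V (λ u → ∑ V (λ v → ⟦ sat ⁅ u ⁆ ⁅ v ⁆ ⟧))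
      lemma : ∀ a b → (a + b) + (a + b) ≡ 2 * a + 2 * b
      lemma = solve-∀
      pointwise : ∀ a b → ⟦ a ⟧ ≤ ⟦ a ∧ not b ⟧ + ⟦ b ⟧
      pointwise false b     = z≤n
      pointwise true  true  = ≤-refl
      pointwise true  false = ≤-refl
      e≤ : edges G ≤ U + σ
      e≤ = begin
        edges G
          ≤⟨ edges≤∑ G ⟩
        ∑ V (λ u → ∑ V (λ v → ⟦ Adj G u v ⟧))
          ≤⟨ ∑-mono V (λ u → ∑-mono V (λ v → pointwise (Adj G u v) (sat ⁅ u ⁆ ⁅ v ⁆))) ⟩
        ∑ V (λ u → ∑ V (λ v → ⟦ usable v u ⟧ + ⟦ sat ⁅ u ⁆ ⁅ v ⁆ ⟧))
          ≡⟨ ∑-cong V (λ u → ∑-+ V _ _) ⟩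
        ∑ V (λ u → ∑ V (λ v → ⟦ usable v u ⟧) + ∑ V (λ v → ⟦ sat ⁅ u ⁆ ⁅ v ⁆ ⟧))
          ≡⟨ ∑-+ V _ _ ⟩
        ∑ V (λ u → ∑ V (λ v → ⟦ usable v u ⟧)) + σ
          ≡⟨ cong (_+ σ) (∑-swap V V (λ u v → ⟦ usable v u ⟧)) ⟩
        U + σ ∎
      2σ<e : 2 * σ < edges G
      2σ<e = *-cancelʳ-< (D 1 1) _ _ (begin-strict
        2 * σ * D 1 1                ≡⟨ *-assoc 2 σ (D 1 1) ⟩
        2 * (σ * D 1 1)              ≤⟨ *-monoʳ-≤ 2 (few-saturated-edges H sizes) ⟩
        2 * (s * t * length H)       <⟨ H-small ⟩
        edges G * D 1 1              ∎)

    common : Vec (Fin n) s → ℕ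
    common us = ∑ V (λ v → ⟦ good v us ⟧)

    -- By `half-usable` and `e-large` the usable degrees sum to at least `4 * n * L`. Summing
    -- `shifted-power` over all `v` gives `4 * n * L ^ s` minus an error of `2 * n * L ^ s`; what
    -- remains is twice the bound claimed, hence the strict inequality.
    many-good-pairs : n * L ^ s < ∑ (tuples n s) common
    many-good-pairs = begin-strict
      n * L ^ s                    <⟨ m<m+n (n * L ^ s) nLˢ>0 ⟩
      n * L ^ s + n * L ^ s        ≤⟨ *-cancelˡ-≤ 2 2nLˢ≤Z ⟩
      Z                            ≡⟨ ∑-swap V (tuples n s) (λ v us → ⟦ good v us ⟧) ⟩
      ∑ (tuples n s) common        ∎
      where
      open ≤-Reasoning
      Z = ∑ V (λ v → ∑ (tuples n s) (λ us → ⟦ good v us ⟧))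
      nLˢ>0 : 0 < n * L ^ s
      nLˢ>0 = >-nonZero⁻¹ _ {{m*n≢0 n (L ^ s) {{n≢0}} {{m^n≢0 L s {{L≢0}}}}}}
      upper : L ^ s′ * ∑ V usableDegree ≤ Z + n * (2 * L ^ s)
      upper = begin
        L ^ s′ * ∑ V usableDegree
          ≡⟨ ∑-*ˡ V (L ^ s′) usableDegree ⟨
        ∑ V (λ v → L ^ s′ * usableDegree v)
          ≤⟨ ∑-mono V (λ v → ≤-trans (shifted-power (usableDegree v) L s′)
               (+-monoˡ-≤ (2 * L ^ s) (many-good-tuples v s ≤-refl))) ⟩
        ∑ V (λ v → ∑ (tuples n s) (λ us → ⟦ good v us ⟧) + 2 * L ^ s)
          ≡⟨ ∑-+ V _ _ ⟩
        Z + ∑ V (λ _ → 2 * L ^ s)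
          ≡⟨ cong (Z +_) (trans (∑-const V _) (cong (_* (2 * L ^ s)) (length-allFin n))) ⟩
        Z + n * (2 * L ^ s) ∎
      2nLˢ≤Z : 2 * (n * L ^ s + n * L ^ s) ≤ 2 * Z
      2nLˢ≤Z = +-cancelʳ-≤ (2 * (n * (2 * L ^ s))) _ _ (begin
        2 * (n * L ^ s + n * L ^ s) + 2 * (n * (2 * L ^ s))
          ≡⟨ lemma₁ n L (L ^ s′) ⟩
        L ^ s′ * (8 * n * L)
          ≤⟨ *-monoʳ-≤ (L ^ s′) (≤-trans e-large half-usable) ⟩
        L ^ s′ * (2 * ∑ V usableDegree)
          ≡⟨ lemma₂ (L ^ s′) _ ⟩
        2 * (L ^ s′ * ∑ V usableDegree)
          ≤⟨ *-monoʳ-≤ 2 upper ⟩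
        2 * (Z + n * (2 * L ^ s))
          ≡⟨ *-distribˡ-+ 2 Z _ ⟩
        2 * Z + 2 * (n * (2 * L ^ s)) ∎)
        where
        lemma₁ : ∀ a b c → 2 * (a * (b * c) + a * (b * c)) + 2 * (a * (2 * (b * c))) ≡ c * (8 * a * b)
        lemma₁ = solve-∀
        lemma₂ : ∀ a b → a * (2 * b) ≡ 2 * (a * b)
        lemma₂ = solve-∀

    -- An average over `n ^ s` tuples; the factor `n ^ s′` replaces division of `L ^ s` by `n ^ s′`.
    popular-tuple : ∃ λ us → L ^ s < n ^ s′ * common us
    popular-tuple = pigeonhole (tuples n s) (λ us → n ^ s′ * common us) (L ^ s) (begin-strict
      length (tuples n s) * L ^ s                       ≡⟨ cong (_* L ^ s) (length-tuples n s) ⟩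
      n * n ^ s′ * L ^ s                                ≡⟨ lemma n (n ^ s′) (L ^ s) ⟩
      n ^ s′ * (n * L ^ s)                              <⟨ *-monoʳ-< (n ^ s′) {{m^n≢0 n s′ {{n≢0}}}} many-good-pairs ⟩
      n ^ s′ * ∑ (tuples n s) common                    ≡⟨ ∑-*ˡ (tuples n s) (n ^ s′) common ⟨
      ∑ (tuples n s) (λ us → n ^ s′ * common us)        ∎)
      where
      open ≤-Reasoning
      lemma : ∀ a b c → a * b * c ≡ b * (a * c)
      lemma = solve-∀

    -- Greedy choice of `T` for a fixed tuple `us`

    module _ (us : Vec (Fin n) s) (large : P * Q < common us) where

      record Extension (r : ℕ) : Set where
        field
          vs          : Vec (Fin n) r
          distinct    : ∣ setOf vs ∣ ≡ r
          vs-good     : ∀ {v} → v ∈ˢ setOf vs → good v us ≡ true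
          unsaturated : ∀ {A B} → A ∈ subsets⁺ us → B ∈ subsets⁺ vs → Unsat A B

      -- At most `t` repetition tests and `2 ^ s * 2 ^ t` tests for pairs `(A , B)` each exclude at
      -- most `t * Q` vertices, `P * Q` in total. Since `us` is good for more vertices than that,
      -- one survives.
      extend : ∀ {r} → r < t → Extension r → Extension (suc r)
      extend {r} r<t ext = record
        { vs = v ∷ vs
        ; distinct = trans (x∉p⇒∣p∪⁅x⁆∣ (setOf vs) v
            (≟-tests⇒∉ vs (λ b∈ → none⇒false fresh (∈-++⁺ˡ b∈)))) (cong suc distinct)
        ; vs-good = vs-good′
        ; unsaturated = unsaturated′
        }
        where
        open Extension ext
        open ≤-Reasoning
        test : Subset n → Subset n → Fin n → Bool
        test A B v = sat A (B ∪ ⁅ v ⁆)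
        tests : List (Fin n → Bool)
        tests = ≟-tests vs ++ cartesianProductWith test (subsets⁺ us) (subsets⁺ vs)
        few : ∀ {b} → b ∈ tests → ∑ V (λ v → ⟦ b v ⟧) ≤ t * Q
        few b∈ with ∈-++⁻ (≟-tests vs) b∈
        ... | inj₁ b∈≟ = ∑-≟-tests vs (≤-trans (>-nonZero⁻¹ Q) (m≤n*m Q t)) b∈≟
        ... | inj₂ b∈× with ∈-cartesianProductWith⁻ test (subsets⁺ us) (subsets⁺ vs) b∈×
        ...   | A , B , A∈ , B∈ , refl = few-saturatedʳ H sizes (unsaturated A∈ B∈)
        length-tests : length tests ≤ t + 2 ^ s * 2 ^ t
        length-tests = ≤-trans
          (≤-reflexive (trans (length-++ (≟-tests vs))
            (cong₂ _+_ (length-≟-tests vs) (length-cartesianProductWith test (subsets⁺ us) (subsets⁺ vs)))))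
          (+-mono-≤ (<⇒≤ r<t) (*-mono-≤ (length-subsets⁺≤ us ≤-refl) (length-subsets⁺≤ vs (<⇒≤ r<t))))
        candidates : ℕ
        candidates = ∑ V (λ v → ⟦ good v us ∧ none tests v ⟧)
        chosen : ∃ λ v → 0 < ⟦ good v us ∧ none tests v ⟧
        chosen = pigeonhole V _ 0 (+-cancelʳ-< (P * Q) _ _ (begin-strict
          length V * 0 + P * Q                       ≡⟨ cong (_+ P * Q) (*-zeroʳ (length V)) ⟩
          P * Q                                      <⟨ large ⟩
          common us                                  ≤⟨ ∑-avoid V (λ v → good v us) (t * Q) tests (All.tabulate few) ⟩
          candidates + length tests * (t * Q)        ≤⟨ +-monoʳ-≤ candidates (*-monoˡ-≤ (t * Q) length-tests) ⟩
          candidates + (t + 2 ^ s * 2 ^ t) * (t * Q) ≡⟨ cong (candidates +_) (*-assoc (t + 2 ^ s * 2 ^ t) t Q) ⟨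
          candidates + P * Q                         ∎))
        v : Fin n
        v = proj₁ chosen
        v-good : good v us ≡ true
        v-good = proj₁ (∧-true (⟦⟧>0⇒true (proj₂ chosen)))
        fresh : none tests v ≡ true
        fresh = proj₂ (∧-true (⟦⟧>0⇒true (proj₂ chosen)))
        vs-good′ : ∀ {w} → w ∈ˢ setOf (v ∷ vs) → good w us ≡ true
        vs-good′ w∈ with x∈p∪q⁻ (setOf vs) ⁅ v ⁆ w∈
        ... | inj₁ w∈vs = vs-good w∈vs
        ... | inj₂ w∈v rewrite x∈⁅y⁆⇒x≡y v w∈v = v-good
        unsaturated′ : ∀ {A B} → A ∈ subsets⁺ us → B ∈ subsets⁺ (v ∷ vs) → Unsat A B
        -- The case `B = ⁅ v ⁆` has no test of its own: it follows from `us` being good for `v`.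
        unsaturated′ A∈ (here refl) = good⇒unsaturated v us v-good A∈
        unsaturated′ A∈ (there B∈) with ∈-++⁻ (subsets⁺ vs) B∈
        ... | inj₁ B∈vs = unsaturated A∈ B∈vs
        ... | inj₂ B∈map with ∈-map⁻ (_∪ ⁅ v ⁆) B∈map
        ...   | B′ , B′∈ , refl = ¬saturated⇒ H (none⇒false fresh
                  (∈-++⁺ʳ (≟-tests vs) (∈-cartesianProductWith⁺ test A∈ B′∈)))

      extension : ∀ r → r ≤ t → Extension r
      extension zero _ = record
        { vs = []
        ; distinct = ∣⊥∣≡0 n
        ; vs-good = λ v∈ → ⊥-elim (∉⊥ v∈)
        ; unsaturated = λ _ ()
        }
      extension (suc r) r<t = extend r<t (extension r (<⇒≤ r<t))

    NewPair : Subset n → Subset n → Set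
    NewPair S T = HasSizes s t (S , T) × CompleteBetween G S T ×
      (∀ {A B} → Nonempty A → Nonempty B → A ⊆ˢ S → B ⊆ˢ T → Unsat A B)

    new-pair : n ^ s′ * (P * Q) ≤ L ^ s → ∃ λ S → ∃ λ T → NewPair S T
    new-pair Q-small = setOf us , setOf vs ,
      (good⇒distinct (proj₁ some-v) us (⟦⟧>0⇒true (proj₂ some-v)) , distinct) ,
      (λ u v u∈ v∈ → good⇒adjacent v us (vs-good v∈) u∈) ,
      (λ A≢∅ B≢∅ A⊆ B⊆ → unsaturated (⊆⇒∈subsets⁺ us A≢∅ A⊆) (⊆⇒∈subsets⁺ vs B≢∅ B⊆))
      where
      us = proj₁ popular-tuple
      large : P * Q < common us
      -- `Q-small` is exactly what makes the popular tuple good for more than `P * Q` vertices.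
      large = *-cancelˡ-< (n ^ s′) _ _ (≤-<-trans Q-small (proj₂ popular-tuple))
      open Extension (extension us large t ≤-refl)
      -- Distinctness of the entries of `us` is read off from its goodness for any single vertex.
      some-v : ∃ λ v → 0 < ⟦ good v us ⟧
      some-v = pigeonhole V _ 0 (subst (_< common us) (sym (*-zeroʳ (length V))) (≤-<-trans z≤n large))

-- Growing the family

0<∣p∣⇒Nonempty : ∀ {n} {p : Subset n} → 0 < ∣ p ∣ → Nonempty p
0<∣p∣⇒Nonempty {n} {p} 0<p with nonempty? p
... | yes ne = ne
... | no  ¬ne = ⊥-elim (n≮n 0 (subst (0 <_) (trans (cong ∣_∣ (Empty-unique ¬ne)) (∣⊥∣≡0 n)) 0<p))

∈⇒0<dH : ∀ {n} {H : List (Subset n × Subset n)} {S T} → (S , T) ∈ H → 0 < dH H S T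
∈⇒0<dH {H = (S , T) ∷ H} (here refl) rewrite dH-∷ S T H S T with S ⊆? S | T ⊆? T
... | yes _ | yes _ = s≤s z≤n
... | no ¬p | _     = ⊥-elim (¬p id)
... | _     | no ¬p = ⊥-elim (¬p id)
∈⇒0<dH {H = (S′ , T′) ∷ H} {S} {T} (there ∈H) rewrite dH-∷ S′ T′ H S T = ≤-trans (∈⇒0<dH ∈H) (m≤n+m _ _)

m≤2stm : ∀ s t m → m ≤ 2 * (suc s * suc t * m)
m≤2stm s t m = begin
  m                              ≤⟨ m≤n*m m (suc t) ⟩
  suc t * m                      ≤⟨ m≤n*m (suc t * m) (suc s) ⟩
  suc s * (suc t * m)            ≡⟨ *-assoc (suc s) (suc t) m ⟨
  suc s * suc t * m              ≤⟨ m≤n*m (suc s * suc t * m) 2 ⟩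
  2 * (suc s * suc t * m)        ∎
  where open ≤-Reasoning

module Saturate {n} (G : Graph n) (s′ t′ M Q : ℕ)
  .{{n≢0 : NonZero n}} .{{M≢0 : NonZero M}} .{{Q≢0 : NonZero Q}} where

  open Saturation s′ t′ M Q

  record Balanced (H : List (Subset n × Subset n)) : Set where
    field
      unique   : Unique H
      sizes    : All (HasSizes s t) H
      complete : All (λ (S , T) → CompleteBetween G S T) H
      bounded  : ∀ A B → Nonempty A → Nonempty B → dH H A B ≤ D ∣ A ∣ ∣ B ∣

  -- Only sub-pairs of `(S , T)` gain codegree. They gain one and were strictly below their
  -- threshold.
  add : ∀ {H S T} → Balanced H → HasSizes s t (S , T) → CompleteBetween G S T →
        (∀ {A B} → Nonempty A → Nonempty B → A ⊆ˢ S → B ⊆ˢ T → Unsaturated H A B) →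
        Balanced ((S , T) ∷ H)
  add {H} {S} {T} bal (S-size , T-size) complete′ unsat = record
    -- The threshold of `(S , T)` itself is `1`, so unsaturation means codegree zero and the pair
    -- cannot already belong to `H`.
    { unique = All.tabulate (λ { ∈H refl → n≮n 0 (<-≤-trans (∈⇒0<dH ∈H) (s≤s⁻¹ dH<1)) }) ∷ unique
    ; sizes = (S-size , T-size) ∷ sizes
    ; complete = complete′ ∷ complete
    ; bounded = bounded′
    }
    where
    open Balanced bal
    S≢∅ : Nonempty S
    S≢∅ = 0<∣p∣⇒Nonempty (≤-trans (s≤s z≤n) (≤-reflexive (sym S-size)))
    T≢∅ : Nonempty T
    T≢∅ = 0<∣p∣⇒Nonempty (≤-trans (s≤s z≤n) (≤-reflexive (sym T-size)))
    D≡1 : D ∣ S ∣ ∣ T ∣ ≡ 1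
    D≡1 = trans (cong₂ D S-size T-size) (cong₂ (λ i j → M ^ i * Q ^ j) (n∸n≡0 s) (n∸n≡0 t))
    dH<1 : dH H S T < 1
    dH<1 = <-≤-trans (unsat S≢∅ T≢∅ id id) (≤-reflexive D≡1)
    bounded′ : ∀ A B → Nonempty A → Nonempty B → dH ((S , T) ∷ H) A B ≤ D ∣ A ∣ ∣ B ∣
    bounded′ A B A≢∅ B≢∅ rewrite dH-∷ S T H A B with A ⊆? S | B ⊆? T
    ... | yes A⊆S | yes B⊆T = unsat A≢∅ B≢∅ A⊆S B⊆T
    ... | yes _   | no _    = bounded A B A≢∅ B≢∅
    ... | no _    | _       = bounded A B A≢∅ B≢∅

  module _ (e-large : 8 * n * L ≤ edges G) (Q-small : n ^ s′ * (P * Q) ≤ L ^ s) where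

    Large : List (Subset n × Subset n) → Set
    Large H = edges G * D 1 1 ≤ 2 * (s * t * length H)

    enlarge : ∀ {H} → Balanced H → ¬ Large H → ∃ λ H′ → Balanced H′ × length H′ ≡ suc (length H)
    enlarge {H} bal ¬large =
      let S , T , sizes′ , complete′ , unsat =
            Augmentation.new-pair G s′ t′ M Q {{M≢0}} {{Q≢0}} H (Balanced.sizes bal) {{n≢0}}
              (≰⇒> ¬large) e-large Q-small
      in (S , T) ∷ H , add bal sizes′ complete′ unsat , refl

    -- After `m` rounds the family has either become large, and is then kept, or has exactly `m`
    -- members.
    Grown : ℕ → Set
    Grown m = ∃ λ H → Balanced H × (Large H ⊎ length H ≡ m)

    grow-step : ∀ {m H} → Balanced H → length H ≡ m → Dec (Large H) → Grown (suc m)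
    grow-step bal eq (yes large) = _ , bal , inj₁ large
    grow-step bal eq (no ¬large) =
      let H′ , bal′ , eq′ = enlarge bal ¬large in H′ , bal′ , inj₂ (trans eq′ (cong suc eq))

    grow : ∀ m → Grown m
    grow zero    = [] , record { unique = [] ; sizes = [] ; complete = [] ; bounded = λ _ _ _ _ → z≤n } , inj₂ refl
    grow (suc m) = continue (grow m)
      where
      continue : Grown m → Grown (suc m)
      continue (H , bal , inj₁ large) = H , bal , inj₁ large
      continue (H , bal , inj₂ eq)    = grow-step bal eq (edges G * D 1 1 ≤? 2 * (s * t * length H))

    large-balanced : ∃ λ H → Balanced H × Large H
    large-balanced = conclude (grow (edges G * D 1 1))
      where
      conclude : Grown (edges G * D 1 1) → ∃ λ H → Balanced H × Large H
      conclude (H , bal , inj₁ large) = H , bal , large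
      -- The number of rounds equals the target `edges G * D 1 1`, so a family with that many
      -- members is itself large.
      conclude (H , bal , inj₂ eq)    = H , bal , ≤-trans (≤-reflexive (sym eq)) (m≤2stm s′ t′ (length H))

-- Choice of M and Q

^-distribʳ-* : ∀ m n k → (m * n) ^ k ≡ m ^ k * n ^ k
^-distribʳ-* m n zero    = refl
^-distribʳ-* m n (suc k) rewrite ^-distribʳ-* m n k = lemma m n (m ^ k) (n ^ k)
  where
  lemma : ∀ a b c d → a * b * (c * d) ≡ a * c * (b * d)
  lemma = solve-∀

^-cancel-≤ : ∀ {m n} k .{{_ : NonZero k}} → m ^ k ≤ n ^ k → m ≤ n
^-cancel-≤ k le = ≮⇒≥ λ n<m → <⇒≱ (^-monoˡ-< k n<m) le

-- The quotient is at least one, so the remainder is at most `n * (m / n)` and rounding down costs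
-- at most a factor of two.
quotient-bounds : ∀ m n .{{_ : NonZero n}} → n ≤ m →
                  NonZero (m / n) × n * (m / n) ≤ m × m ≤ 2 * (n * (m / n))
quotient-bounds m n n≤m = >-nonZero (m≥n⇒m/n>0 n≤m) , lower , upper
  where
  open ≤-Reasoning
  lower : n * (m / n) ≤ m
  lower = ≤-trans (≤-reflexive (*-comm n (m / n))) (m/n*n≤m m n)
  upper : m ≤ 2 * (n * (m / n))
  upper = begin
    m                                  ≡⟨ m≡m%n+[m/n]*n m n ⟩
    m % n + m / n * n                  ≤⟨ +-monoˡ-≤ (m / n * n) (<⇒≤ (m%n<n m n)) ⟩
    n + m / n * n                      ≤⟨ +-monoˡ-≤ (m / n * n) (m≤n*m n (m / n) {{>-nonZero (m≥n⇒m/n>0 n≤m)}}) ⟩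
    m / n * n + m / n * n              ≡⟨ lemma (m / n) n ⟩
    2 * (n * (m / n))                  ∎
    where
    lemma : ∀ a b → a * b + a * b ≡ 2 * (b * a)
    lemma = solve-∀

m≤m^k : ∀ m k .{{_ : NonZero m}} → m ≤ m ^ suc k
m≤m^k m k = m≤m*n m (m ^ k) {{m^n≢0 m k}}

-- Bounds `e ^ s` by a multiple of `Q * n ^ N`: the factor `16 ^ s` comes from `M-lower` and `2 * P`
-- from `Q-lower`.
eˢ-factor : ℕ → ℕ → ℕ
eˢ-factor s′ P = 16 ^ suc s′ * (2 * P)

-- The inverse of the density constant in (a): `t′` factors come from replacing `e ^ s` by `Q`, and
-- `s′` from replacing `e` by `M`.
size-factor : ℕ → ℕ → ℕ → ℕ → ℕ → ℕ
size-factor s′ t′ K P c = eˢ-factor s′ P ^ t′ * (16 * K) ^ s′ * c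

-- n, e and s = 1 + s′ are as in the theorem, and N = 2s − 1.
module Arithmetic (s′ n e K P N : ℕ) .{{n≢0 : NonZero n}} .{{K≢0 : NonZero K}} .{{P≢0 : NonZero P}}
  (n^N : n ^ N ≡ n ^ s′ * n ^ suc s′) where

  open ≤-Reasoning
  s : ℕ
  s = suc s′

  -- Writing `e = k n^(2-1/s)`, one has `e ^ s = k ^ s * n ^ N`, so `dense` says that `k` is at
  -- least `16 * P * K`.
  module _ (dense : (16 * P * K) ^ s * n ^ N ≤ e ^ s) where

    -- Makes `M` positive. It follows from density because `n ^ s ≤ n ^ N`.
    n[8K]≤e : n * (8 * K) ≤ e
    n[8K]≤e = ^-cancel-≤ s (begin
      (n * (8 * K)) ^ s                ≤⟨ ^-monoˡ-≤ s (*-monoʳ-≤ n (*-monoˡ-≤ K 8≤16P)) ⟩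
      (n * (16 * P * K)) ^ s           ≡⟨ ^-distribʳ-* n (16 * P * K) s ⟩
      n ^ s * (16 * P * K) ^ s         ≡⟨ *-comm (n ^ s) _ ⟩
      (16 * P * K) ^ s * n ^ s         ≤⟨ *-monoʳ-≤ ((16 * P * K) ^ s) (m≤n*m (n ^ s) (n ^ s′) {{m^n≢0 n s′ {{n≢0}}}}) ⟩
      (16 * P * K) ^ s * (n ^ s′ * n ^ s) ≡⟨ cong ((16 * P * K) ^ s *_) n^N ⟨
      (16 * P * K) ^ s * n ^ N         ≤⟨ dense ⟩
      e ^ s                            ∎)
      where
      8≤16P : 8 ≤ 16 * P
      8≤16P = ≤-trans (m≤n+m 8 8) (m≤m*n 16 P {{P≢0}})

    -- Makes `Q` positive when used with `X = K * M`. The single factor `P` is absorbed by `P ^ s`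
    -- from the density constant.
    [nˢ′P]≤Xˢ : ∀ X → e ≤ 16 * n * X → n ^ s′ * P ≤ X ^ s
    [nˢ′P]≤Xˢ X e≤ = *-cancelˡ-≤ ((16 * n) ^ s) {{m^n≢0 (16 * n) s {{m*n≢0 16 n {{_}} {{n≢0}}}}}} (begin
      (16 * n) ^ s * (n ^ s′ * P)              ≡⟨ cong (_* (n ^ s′ * P)) (^-distribʳ-* 16 n s) ⟩
      16 ^ s * n ^ s * (n ^ s′ * P)            ≡⟨ lemma (16 ^ s) (n ^ s) (n ^ s′) P ⟩
      16 ^ s * P * (n ^ s′ * n ^ s)            ≤⟨ *-monoˡ-≤ _ (*-monoʳ-≤ (16 ^ s) (m≤m^k P s′ {{P≢0}})) ⟩
      16 ^ s * P ^ s * (n ^ s′ * n ^ s)        ≡⟨ cong (_* (n ^ s′ * n ^ s)) (^-distribʳ-* 16 P s) ⟨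
      (16 * P) ^ s * (n ^ s′ * n ^ s)          ≤⟨ *-monoˡ-≤ _ (^-monoˡ-≤ s (m≤m*n (16 * P) K {{K≢0}})) ⟩
      (16 * P * K) ^ s * (n ^ s′ * n ^ s)      ≡⟨ cong ((16 * P * K) ^ s *_) n^N ⟨
      (16 * P * K) ^ s * n ^ N                 ≤⟨ dense ⟩
      e ^ s                                    ≤⟨ ^-monoˡ-≤ s e≤ ⟩
      (16 * n * X) ^ s                         ≡⟨ ^-distribʳ-* (16 * n) X s ⟩
      (16 * n) ^ s * X ^ s                     ∎)
      where
      lemma : ∀ a b c d → a * b * (c * d) ≡ a * d * (c * b)
      lemma = solve-∀

    -- Here `K * M` is the `L` of the saturation argument. The upper bounds are the hypotheses under
    -- which a new pair exists; the lower bounds make the resulting family large enough for (a).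
    record Thresholds : Set where
      field
        M Q     : ℕ
        {{M≢0}} : NonZero M
        {{Q≢0}} : NonZero Q
        M-upper : 8 * n * (K * M) ≤ e
        M-lower : e ≤ 16 * n * (K * M)
        Q-upper : n ^ s′ * (P * Q) ≤ (K * M) ^ s
        Q-lower : (K * M) ^ s ≤ 2 * (n ^ s′ * (P * Q))

    thresholds : Thresholds
    thresholds = record
      { M = M ; Q = Q ; M≢0 = proj₁ M-bounds ; Q≢0 = proj₁ Q-bounds
      ; M-upper = ≤-trans (≤-reflexive (lemma₁ n K M)) (proj₁ (proj₂ M-bounds))
      ; M-lower = M-lower
      ; Q-upper = ≤-trans (≤-reflexive (lemma₂ (n ^ s′) P Q)) (proj₁ (proj₂ Q-bounds))
      ; Q-lower = ≤-trans (proj₂ (proj₂ Q-bounds)) (≤-reflexive (cong (2 *_) (sym (lemma₂ (n ^ s′) P Q))))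
      }
      where
      instance
        8K≢0 : NonZero (8 * K)
        8K≢0 = m*n≢0 8 K {{_}} {{K≢0}}
        n8K≢0 : NonZero (n * (8 * K))
        n8K≢0 = m*n≢0 n (8 * K) {{n≢0}}
        nˢ′P≢0 : NonZero (n ^ s′ * P)
        nˢ′P≢0 = m*n≢0 (n ^ s′) P {{m^n≢0 n s′ {{n≢0}}}} {{P≢0}}
      M Q : ℕ
      M = e / (n * (8 * K))
      Q = (K * M) ^ s / (n ^ s′ * P)
      lemma₁ : ∀ a b c → 8 * a * (b * c) ≡ a * (8 * b) * c
      lemma₁ = solve-∀
      lemma₂ : ∀ a b c → a * (b * c) ≡ a * b * c
      lemma₂ = solve-∀
      lemma₃ : ∀ a b c → 2 * (a * (8 * b) * c) ≡ 16 * a * (b * c)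
      lemma₃ = solve-∀
      M-bounds : NonZero M × n * (8 * K) * M ≤ e × e ≤ 2 * (n * (8 * K) * M)
      M-bounds = quotient-bounds e (n * (8 * K)) n[8K]≤e
      M-lower : e ≤ 16 * n * (K * M)
      M-lower = ≤-trans (proj₂ (proj₂ M-bounds)) (≤-reflexive (lemma₃ n K M))
      Q-bounds : NonZero Q × n ^ s′ * P * Q ≤ (K * M) ^ s × (K * M) ^ s ≤ 2 * (n ^ s′ * P * Q)
      Q-bounds = quotient-bounds ((K * M) ^ s) (n ^ s′ * P) ([nˢ′P]≤Xˢ (K * M) M-lower)

    module Consequences (th : Thresholds) where
      open Thresholds th

      nL≤e : n * (K * M) ≤ e
      nL≤e = ≤-trans (≤-trans (m≤n*m (n * (K * M)) 8) (≤-reflexive (sym (*-assoc 8 n (K * M))))) M-upper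

      nM≤e : n * M ≤ e
      nM≤e = ≤-trans (*-monoʳ-≤ n (m≤n*m M K {{K≢0}})) nL≤e

      -- In terms of `k` this is `Q ≤ k^s`, just as `nM≤e` is `M ≤ k n^((s-1)/s)`; together they
      -- allow `δ = 1`.
      Qn^N≤eˢ : Q * n ^ N ≤ e ^ s
      Qn^N≤eˢ = begin
        Q * n ^ N                      ≤⟨ *-monoˡ-≤ (n ^ N) (m≤n*m Q P {{P≢0}}) ⟩
        P * Q * n ^ N                  ≡⟨ cong (P * Q *_) n^N ⟩
        P * Q * (n ^ s′ * n ^ s)       ≡⟨ lemma (P * Q) (n ^ s′) (n ^ s) ⟩
        n ^ s * (n ^ s′ * (P * Q))     ≤⟨ *-monoʳ-≤ (n ^ s) Q-upper ⟩
        n ^ s * (K * M) ^ s            ≡⟨ ^-distribʳ-* n (K * M) s ⟨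
        (n * (K * M)) ^ s              ≤⟨ ^-monoˡ-≤ s nL≤e ⟩
        e ^ s                          ∎
        where
        lemma : ∀ a b c → a * (b * c) ≡ c * (b * a)
        lemma = solve-∀

      -- With `a = s ∸ ∣ A ∣` and `b = t ∸ ∣ B ∣`, clearing the powers of `n` pairs each `M` with
      -- one `n` and each `Q` with `n ^ N`.
      codegree-bound : ∀ a b d → d ≤ M ^ a * Q ^ b → d * n ^ (a + N * b) ≤ e ^ (a + s * b)
      codegree-bound a b d d≤ = begin
        d * n ^ (a + N * b)                          ≤⟨ *-monoˡ-≤ _ d≤ ⟩
        M ^ a * Q ^ b * n ^ (a + N * b)              ≡⟨ cong (M ^ a * Q ^ b *_) (^-distribˡ-+-* n a (N * b)) ⟩
        M ^ a * Q ^ b * (n ^ a * n ^ (N * b))        ≡⟨ cong (λ x → M ^ a * Q ^ b * (n ^ a * x)) (^-*-assoc n N b) ⟨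
        M ^ a * Q ^ b * (n ^ a * (n ^ N) ^ b)        ≡⟨ lemma (M ^ a) (Q ^ b) (n ^ a) ((n ^ N) ^ b) ⟩
        n ^ a * M ^ a * (Q ^ b * (n ^ N) ^ b)        ≡⟨ cong₂ _*_ (^-distribʳ-* n M a) (^-distribʳ-* Q (n ^ N) b) ⟨
        (n * M) ^ a * (Q * n ^ N) ^ b                ≤⟨ *-mono-≤ (^-monoˡ-≤ a nM≤e) (^-monoˡ-≤ b Qn^N≤eˢ) ⟩
        e ^ a * (e ^ s) ^ b                          ≡⟨ cong (e ^ a *_) (^-*-assoc e s b) ⟩
        e ^ a * e ^ (s * b)                          ≡⟨ ^-distribˡ-+-* e a (s * b) ⟨
        e ^ (a + s * b)                              ∎
        where
        lemma : ∀ a b c d → a * b * (c * d) ≡ c * a * (b * d)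
        lemma = solve-∀

      R : ℕ
      R = eˢ-factor s′ P

      eˢ≤ : e ^ s ≤ R * (Q * n ^ N)
      eˢ≤ = begin
        e ^ s                                               ≤⟨ ^-monoˡ-≤ s M-lower ⟩
        (16 * n * (K * M)) ^ s                              ≡⟨ ^-distribʳ-* (16 * n) (K * M) s ⟩
        (16 * n) ^ s * (K * M) ^ s                          ≡⟨ cong (_* (K * M) ^ s) (^-distribʳ-* 16 n s) ⟩
        16 ^ s * n ^ s * (K * M) ^ s                        ≤⟨ *-monoʳ-≤ (16 ^ s * n ^ s) Q-lower ⟩
        16 ^ s * n ^ s * (2 * (n ^ s′ * (P * Q)))           ≡⟨ lemma (16 ^ s) (n ^ s) (n ^ s′) P Q ⟩
        R * (Q * (n ^ s′ * n ^ s))                          ≡⟨ cong (λ x → R * (Q * x)) n^N ⟨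
        R * (Q * n ^ N)                                     ∎
        where
        lemma : ∀ a b c d f → a * b * (2 * (c * (d * f))) ≡ a * (2 * d) * (f * (c * b))
        lemma = solve-∀

      -- Of the `s * suc t′` factors `e`, one is kept for `large`, `s′` are replaced through
      -- `M-lower`, and the remaining `t′` blocks `e ^ s` through `eˢ≤`. The product
      -- `e * (M ^ s′ * Q ^ t′)` is then bounded by `c * h`.
      size-bound : ∀ t′ c h → e * (M ^ s′ * Q ^ t′) ≤ c * h →
                   e ^ (s * suc t′) * n ^ s ≤ size-factor s′ t′ K P c * (h * n ^ (N * suc t′))
      size-bound t′ c h large = begin
        e ^ (s * suc t′) * n ^ s
          ≡⟨ cong (_* n ^ s) (^-*-assoc e s (suc t′)) ⟨
        e ^ s * (e ^ s) ^ t′ * n ^ s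
          ≤⟨ *-monoˡ-≤ (n ^ s) (*-mono-≤ (*-monoʳ-≤ e (^-monoˡ-≤ s′ M-lower)) (^-monoˡ-≤ t′ eˢ≤)) ⟩
        e * (16 * n * (K * M)) ^ s′ * (R * (Q * n ^ N)) ^ t′ * n ^ s
          ≡⟨ cong₂ (λ x y → e * x * y * n ^ s) power₁ power₂ ⟩
        e * ((16 * K) ^ s′ * (n ^ s′ * M ^ s′)) * (R ^ t′ * (Q ^ t′ * (n ^ N) ^ t′)) * n ^ s
          ≡⟨ lemma₁ e ((16 * K) ^ s′) (n ^ s′) (M ^ s′) (R ^ t′) (Q ^ t′) ((n ^ N) ^ t′) (n ^ s) ⟩
        R ^ t′ * (16 * K) ^ s′ * (e * (M ^ s′ * Q ^ t′)) * (n ^ s′ * n ^ s * (n ^ N) ^ t′)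
          ≤⟨ *-monoˡ-≤ _ (*-monoʳ-≤ (R ^ t′ * (16 * K) ^ s′) large) ⟩
        R ^ t′ * (16 * K) ^ s′ * (c * h) * (n ^ s′ * n ^ s * (n ^ N) ^ t′)
          ≡⟨ cong (λ x → R ^ t′ * (16 * K) ^ s′ * (c * h) * x) power₃ ⟩
        R ^ t′ * (16 * K) ^ s′ * (c * h) * n ^ (N * suc t′)
          ≡⟨ lemma₂ (R ^ t′ * (16 * K) ^ s′) c h (n ^ (N * suc t′)) ⟩
        R ^ t′ * (16 * K) ^ s′ * c * (h * n ^ (N * suc t′)) ∎
        where
        swap : ∀ a b c d → a * b * (c * d) ≡ a * c * (b * d)
        swap = solve-∀
        lemma₁ : ∀ e k a m r q b a′ →
                 e * (k * (a * m)) * (r * (q * b)) * a′ ≡ r * k * (e * (m * q)) * (a * a′ * b)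
        lemma₁ = solve-∀
        lemma₂ : ∀ a b c d → a * (b * c) * d ≡ a * b * (c * d)
        lemma₂ = solve-∀
        power₁ : (16 * n * (K * M)) ^ s′ ≡ (16 * K) ^ s′ * (n ^ s′ * M ^ s′)
        power₁ = trans (cong (_^ s′) (swap 16 n K M))
          (trans (^-distribʳ-* (16 * K) (n * M) s′) (cong ((16 * K) ^ s′ *_) (^-distribʳ-* n M s′)))
        power₂ : (R * (Q * n ^ N)) ^ t′ ≡ R ^ t′ * (Q ^ t′ * (n ^ N) ^ t′)
        power₂ = trans (^-distribʳ-* R (Q * n ^ N) t′) (cong (R ^ t′ *_) (^-distribʳ-* Q (n ^ N) t′))
        power₃ : n ^ s′ * n ^ s * (n ^ N) ^ t′ ≡ n ^ (N * suc t′)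
        power₃ = trans (cong (_* (n ^ N) ^ t′) (sym n^N)) (^-*-assoc n N (suc t′))

-- Passage to the rationals

-- Proved on unnormalised rationals, where both factors have denominator one.
fromℕ-* : ∀ m n → fromℕ (m * n) ≡ fromℕ m *ℚ fromℕ n
fromℕ-* m n = ℚ.toℚᵘ-injective (begin-equality
  ℚ.toℚᵘ (fromℕ (m * n))                             ≃⟨ ℚ.toℚᵘ-fromℚᵘ (mkℚᵘ (ℤ.+ (m * n)) 0) ⟩
  mkℚᵘ (ℤ.+ (m * n)) 0                               ≃⟨ *≡* (cong (ℤ._* (ℤ.+ 1)) (ℤ.pos-* m n)) ⟩
  mkℚᵘ (ℤ.+ m) 0 ℚᵘ* mkℚᵘ (ℤ.+ n) 0                  ≃⟨ ℚᵘ.*-cong (ℚ.toℚᵘ-fromℚᵘ (mkℚᵘ (ℤ.+ m) 0)) (ℚ.toℚᵘ-fromℚᵘ (mkℚᵘ (ℤ.+ n) 0)) ⟨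
  ℚ.toℚᵘ (fromℕ m) ℚᵘ* ℚ.toℚᵘ (fromℕ n)              ≃⟨ ℚ.toℚᵘ-homo-* (fromℕ m) (fromℕ n) ⟨
  ℚ.toℚᵘ (fromℕ m *ℚ fromℕ n)                        ∎)
  where
  open ℚᵘ.≤-Reasoning
  open import Data.Rational.Unnormalised using () renaming (_*_ to _ℚᵘ*_)

fromℕ-mono : ∀ {m n} → m ≤ n → fromℕ m ≤ℚ fromℕ n
fromℕ-mono {m} {n} m≤n = ℚ.toℚᵘ-cancel-≤ (begin
  ℚ.toℚᵘ (fromℕ m)      ≃⟨ ℚ.toℚᵘ-fromℚᵘ (mkℚᵘ (ℤ.+ m) 0) ⟩
  mkℚᵘ (ℤ.+ m) 0        ≤⟨ *≤* (ℤ.*-monoʳ-≤-nonNeg (ℤ.+ 1) (ℤ.+≤+ m≤n)) ⟩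
  mkℚᵘ (ℤ.+ n) 0        ≃⟨ ℚ.toℚᵘ-fromℚᵘ (mkℚᵘ (ℤ.+ n) 0) ⟨
  ℚ.toℚᵘ (fromℕ n)      ∎)
  where open ℚᵘ.≤-Reasoning

fromℕ-^ : ∀ m k → fromℕ (m ^ k) ≡ fromℕ m ^ℚ k
fromℕ-^ m zero    = refl
fromℕ-^ m (suc k) = trans (fromℕ-* m (m ^ k)) (cong (fromℕ m *ℚ_) (fromℕ-^ m k))

1^ℚ : ∀ k → 1ℚ ^ℚ k ≡ 1ℚ
1^ℚ zero    = refl
1^ℚ (suc k) = trans (ℚ.*-identityˡ _) (1^ℚ k)

fromℕ-pos : ∀ m .{{_ : NonZero m}} → ℚ.Positive (fromℕ m)
fromℕ-pos m = ℚ.normalize-pos m 1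

module Reciprocal (m : ℕ) .{{m≢0 : NonZero m}} where

  instance
    fromℕm>0 : ℚ.Positive (fromℕ m)
    fromℕm>0 = fromℕ-pos m
    fromℕm≢0 : ℚ.NonZero (fromℕ m)
    fromℕm≢0 = ℚ.pos⇒nonZero (fromℕ m)

  reciprocal : ℚ
  reciprocal = ℚ.1/ fromℕ m

  instance
    reciprocal>0 : ℚ.Positive reciprocal
    reciprocal>0 = ℚ.1/pos⇒pos (fromℕ m)

  reciprocal-*-≤ : ∀ {x y} → x ≤ m * y → reciprocal *ℚ fromℕ x ≤ℚ fromℕ y
  reciprocal-*-≤ {x} {y} x≤my = begin
    reciprocal *ℚ fromℕ x                   ≤⟨ ℚ.*-monoˡ-≤-nonNeg reciprocal {{ℚ.pos⇒nonNeg reciprocal}} (fromℕ-mono x≤my) ⟩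
    reciprocal *ℚ fromℕ (m * y)             ≡⟨ cong (reciprocal *ℚ_) (fromℕ-* m y) ⟩
    reciprocal *ℚ (fromℕ m *ℚ fromℕ y)      ≡⟨ ℚ.*-assoc reciprocal (fromℕ m) (fromℕ y) ⟨
    reciprocal *ℚ fromℕ m *ℚ fromℕ y        ≡⟨ cong (_*ℚ fromℕ y) (ℚ.*-inverseˡ (fromℕ m)) ⟩
    1ℚ *ℚ fromℕ y                           ≡⟨ ℚ.*-identityˡ (fromℕ y) ⟩
    fromℕ y                                 ∎
    where open ℚ.≤-Reasoning

fromℕ-*-^ : ∀ d m k → fromℕ (d * m ^ k) ≡ fromℕ d *ℚ (fromℕ m ^ℚ k)
fromℕ-*-^ d m k = trans (fromℕ-* d (m ^ k)) (cong (fromℕ d *ℚ_) (fromℕ-^ m k))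

-- The theorem in natural numbers

record BalancedFamily (s t c n : ℕ) (G : Graph n) : Set where
  field
    H         : List (Subset n × Subset n)
    unique    : Unique H
    valid     : ∀ S T → (S , T) ∈ H → (∣ S ∣ ≡ s) × (∣ T ∣ ≡ t) × CompleteBetween G S T
    -- Since `k^(st)` is `e ^ (s * t)` over `n ^ ((2 * s ∸ 1) * t)`, multiplying out removes `k` and
    -- the fractional exponents. The codegree bound is treated alike, with `δ = 1`.
    size      : edges G ^ (s * t) * n ^ s ≤ c * (length H * n ^ ((2 * s ∸ 1) * t))
    codegrees : ∀ A B → 1 ≤ ∣ A ∣ → 1 ≤ ∣ B ∣ →
                dH H A B * n ^ ((s ∸ ∣ A ∣) + (2 * s ∸ 1) * (t ∸ ∣ B ∣))
                  ≤ edges G ^ ((s ∸ ∣ A ∣) + s * (t ∸ ∣ B ∣))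

module _ (s′ t′ : ℕ) where

  private
    s t K P c : ℕ
    s = suc s′
    t = suc t′
    K = blockedˡ s
    P = blockedʳ s t
    c = size-factor s′ t′ K P (2 * (s * t))

    K≢0 : NonZero K
    K≢0 = m*n≢0 (s + 2 ^ s) s

    P≢0 : NonZero P
    P≢0 = m*n≢0 (t + 2 ^ s * 2 ^ t) t

    c≢0 : NonZero c
    c≢0 = m*n≢0 (eˢ-factor s′ P ^ t′ * (16 * K) ^ s′) (2 * (s * t))
      {{m*n≢0 _ _ {{m^n≢0 _ t′ {{m*n≢0 (16 ^ s) (2 * P) {{m^n≢0 16 s}} {{m*n≢0 2 P {{_}} {{P≢0}}}}}}}}
                  {{m^n≢0 (16 * K) s′ {{m*n≢0 16 K {{_}} {{K≢0}}}}}}}}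
      {{m*n≢0 2 (s * t)}}

    n^[2s-1] : ∀ n → n ^ (2 * s ∸ 1) ≡ n ^ s′ * n ^ s
    n^[2s-1] n = trans (cong (λ i → n ^ (s′ + i)) (+-identityʳ s)) (^-distribˡ-+-* n s′ s)

    balanced-family-on : ∀ n .{{n≢0 : NonZero n}} (G : Graph n) →
                         (16 * P * K) ^ s * n ^ (2 * s ∸ 1) ≤ edges G ^ s → BalancedFamily s t c n G
    balanced-family-on n {{n≢0}} G dense = fromBalanced large-balanced
      where
      open Arithmetic s′ n (edges G) K P (2 * s ∸ 1) {{n≢0}} {{K≢0}} {{P≢0}} (n^[2s-1] n)
        using (module Thresholds; thresholds; module Consequences)
      open Thresholds (thresholds dense)
      open Consequences dense (thresholds dense)
      open Saturate G s′ t′ M Q {{n≢0}} {{M≢0}} {{Q≢0}} using (Balanced)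
      open Saturation s′ t′ M Q {{M≢0}} {{Q≢0}} using (D)
      LargeBalanced : Set
      LargeBalanced = ∃ λ H → Balanced H × edges G * D 1 1 ≤ 2 * (s * t * length H)
      large-balanced : LargeBalanced
      large-balanced = Saturate.large-balanced G s′ t′ M Q {{n≢0}} {{M≢0}} {{Q≢0}} M-upper Q-upper
      fromBalanced : LargeBalanced → BalancedFamily s t c n G
      fromBalanced (H , bal , large) = record
        { H = H
        ; unique = unique
        ; valid = λ S T ∈H → let S-size , T-size = All.lookup sizes ∈H in
                             S-size , T-size , All.lookup complete ∈H
        -- `D 1 1` unfolds to `M ^ s′ * Q ^ t′`.
        ; size = size-bound t′ (2 * (s * t)) (length H)
            (≤-trans large (≤-reflexive (sym (*-assoc 2 (s * t) (length H)))))
        ; codegrees = λ A B 1≤A 1≤B → codegree-bound (s ∸ ∣ A ∣) (t ∸ ∣ B ∣) (dH H A B)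
            (bounded A B (0<∣p∣⇒Nonempty 1≤A) (0<∣p∣⇒Nonempty 1≤B))
        }
        where open Balanced bal

  balanced-families : ∃ λ k₀ → ∃ λ c → NonZero c × (∀ n (G : Graph n) →
                      k₀ ^ s * n ^ (2 * s ∸ 1) ≤ edges G ^ s → BalancedFamily s t c n G)
  -- `16 * P * K` is at least `8 * K`, which gives `M ≥ 1`, and at least `16 * P`, which gives
  -- `Q ≥ 1`.
  balanced-families = 16 * P * K , c , c≢0 , λ where
    -- `M` is a quotient by a multiple of `n`, so `n = 0` is separate: `n ^ s` vanishes and no `A`
    -- is nonempty.
    zero G _ → record
      { H = []
      ; unique = []
      ; valid = λ _ _ ()
      ; size = ≤-trans (≤-reflexive (*-zeroʳ (0 ^ (s * t)))) z≤n
      ; codegrees = λ { [] _ () }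
      }
    (suc n) G dense → balanced-family-on (suc n) G dense

theorem7p4 : (s t : ℕ) → 2 ≤ s → s ≤ t →
    Σ ℚ λ C → Σ ℚ λ δ → Σ ℕ λ k₀ → Σ ℚ λ c →
    (0ℚ <ℚ C) × (0ℚ <ℚ δ) × (0ℚ <ℚ c) ×
    ((n : ℕ) (G : Graph n) →
    (k₀ ^ s) * (n ^ (2 * s ∸ 1)) ≤ edges G ^ s →
    Σ (List (Subset n × Subset n)) λ H →
    Unique H ×
    ((S T : Subset n) → (S , T) ∈ H →
    (∣ S ∣ ≡ s) × (∣ T ∣ ≡ t) × CompleteBetween G S T) ×
    (c *ℚ (fromℕ (edges G) ^ℚ (s * t)) *ℚ (fromℕ n ^ℚ s)
    ≤ℚ fromℕ (length H) *ℚ (fromℕ n ^ℚ ((2 * s ∸ 1) * t))) ×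
    ((A B : Subset n) → 1 ≤ ∣ A ∣ → ∣ A ∣ ≤ s → 1 ≤ ∣ B ∣ → ∣ B ∣ ≤ t →
    fromℕ (dH H A B) *ℚ (fromℕ n ^ℚ ((s ∸ ∣ A ∣) + (2 * s ∸ 1) * (t ∸ ∣ B ∣)))
    ≤ℚ
    (δ ^ℚ ((s ∸ ∣ A ∣) + (t ∸ ∣ B ∣)))
    *ℚ (fromℕ (edges G) ^ℚ ((s ∸ ∣ A ∣) + s * (t ∸ ∣ B ∣)))))
theorem7p4 s@(suc s′) t@(suc t′) _ _ = rational-form (balanced-families s′ t′)
  where
  open ℚ.≤-Reasoning
  rational-form : _ → _
  rational-form (k₀ , m , m≢0 , family) =
    -- `δ = 1` since rounding down keeps `M` and `Q` below `e / n` and `e ^ s / n ^ (2 * s ∸ 1)`;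
    -- `c` is the reciprocal of the integer factor `m`.
    1ℚ , 1ℚ , k₀ , reciprocal , ℚ.positive⁻¹ 1ℚ , ℚ.positive⁻¹ 1ℚ , ℚ.positive⁻¹ reciprocal ,
    λ n G dense →
      let open BalancedFamily (family n G dense)
          e = edges G
          N = 2 * s ∸ 1
      in
      H , unique , valid ,
      (begin
        reciprocal *ℚ (fromℕ e ^ℚ (s * t)) *ℚ (fromℕ n ^ℚ s)
          ≡⟨ ℚ.*-assoc reciprocal (fromℕ e ^ℚ (s * t)) (fromℕ n ^ℚ s) ⟩
        reciprocal *ℚ ((fromℕ e ^ℚ (s * t)) *ℚ (fromℕ n ^ℚ s))
          ≡⟨ cong (λ x → reciprocal *ℚ (x *ℚ (fromℕ n ^ℚ s))) (fromℕ-^ e (s * t)) ⟨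
        reciprocal *ℚ (fromℕ (e ^ (s * t)) *ℚ (fromℕ n ^ℚ s))
          ≡⟨ cong (reciprocal *ℚ_) (fromℕ-*-^ (e ^ (s * t)) n s) ⟨
        reciprocal *ℚ fromℕ (e ^ (s * t) * n ^ s)
          ≤⟨ reciprocal-*-≤ size ⟩
        fromℕ (length H * n ^ (N * t))
          ≡⟨ fromℕ-*-^ (length H) n (N * t) ⟩
        fromℕ (length H) *ℚ (fromℕ n ^ℚ (N * t)) ∎) ,
      λ A B 1≤A _ 1≤B _ →
        let i = s ∸ ∣ A ∣
            j = t ∸ ∣ B ∣
        in begin
        fromℕ (dH H A B) *ℚ (fromℕ n ^ℚ (i + N * j))
          ≡⟨ fromℕ-*-^ (dH H A B) n (i + N * j) ⟨
        fromℕ (dH H A B * n ^ (i + N * j))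
          ≤⟨ fromℕ-mono (codegrees A B 1≤A 1≤B) ⟩
        fromℕ (e ^ (i + s * j))
          ≡⟨ fromℕ-^ e (i + s * j) ⟩
        fromℕ e ^ℚ (i + s * j)
          ≡⟨ ℚ.*-identityˡ (fromℕ e ^ℚ (i + s * j)) ⟨
        1ℚ *ℚ (fromℕ e ^ℚ (i + s * j))
          ≡⟨ cong (_*ℚ (fromℕ e ^ℚ (i + s * j))) (1^ℚ (i + j)) ⟨
        (1ℚ ^ℚ (i + j)) *ℚ (fromℕ e ^ℚ (i + s * j)) ∎
    where open Reciprocal m {{m≢0}}
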